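{- Let $A$ be an integer matrix with columns $a_1,\ldots,a_n$, let $\mathcal{L}=\ker(A)\cap\mathbf{Z}^n$, and suppose that the lattice ideal $I_{\mathcal{L}}$ has codimension two (equivalently $\mathcal{L}$ has dimension 2) and $\mathcal{L}\cap\mathbf{N}^n=\{0\}$. If $\mathcal{P}_\tau$ is an embedded prime of $V_{\mathcal{L}}$, then $\mathrm{cone}\{a_i : i\in\tau\}$ is not a face of $\mathrm{cone}\{a_i : i=1,\ldots,n\}$. In particular, the irrelevant maximal ideal $\mathcal{P}_\emptyset=\langle x_1,\ldots,x_n\rangle$ is not an associated prime of $V_{\mathcal{L}}$.
   Context: $S=k[x_1,\ldots,x_n]$, $x^u=\prod_i x_i^{u_i}$. $I_{\mathcal{L}}=\langle x^u-x^v: u,v\in\mathbf{N}^n, u-v\in\mathcal{L}\rangle$. For $u\in\mathbf{N}^n$ the fiber is $P_u=\mathrm{conv}\{v\in\mathbf{N}^n: u-v\in\mathcal{L}\}$; the vertex ideal $V_{\mathcal{L}}$ is the monomial ideal spanned by monomials $x^v$ with $v$ not a vertex of $P_v$. For $\tau\subseteq\{1,\ldots,n\}$, $\mathcal{P}_\tau=\langle x_i : i\notin\tau\rangle$; all associated primes of the monomial ideal $V_{\mathcal{L}}$ are of this form. $\mathrm{cone}$ denotes the nonnegative real span. -}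

module Defs where

open import Data.Nat as ℕ using (ℕ)
open import Data.Integer as ℤ using (ℤ; +_; _-_; _*_; _+_; _≤_)
open import Data.Fin using (Fin; zero; suc)
open import Data.Fin.Subset using (Subset; _∈_; _∉_; _⊆_)
open import Data.Product using (Σ; ∃; _×_; _,_)
open import Relation.Binary.PropositionalEquality using (_≡_; _≢_)
open import Relation.Nullary using (¬_)
open import Function.Bundles using (_⇔_)

Vecℤ : ℕ → Set
Vecℤ n = Fin n → ℤ

Exp : ℕ → Set
Exp n = Fin n → ℕ

Σℤ : ∀ {n} → (Fin n → ℤ) → ℤ
Σℤ {ℕ.zero} f = + 0
Σℤ {ℕ.suc n} f = f zero + Σℤ (λ i → f (suc i))

Σℕ : ∀ {n} → (Fin n → ℕ) → ℕ
Σℕ {ℕ.zero} f = 0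
Σℕ {ℕ.suc n} f = f zero ℕ.+ Σℕ (λ i → f (suc i))

-- An integer d×n matrix: A j i is the entry in row j, column i;
-- the column a_i is  λ j → A j i.
Mat : ℕ → ℕ → Set
Mat d n = Fin d → Fin n → ℤ

InL : ∀ {d n} → Mat d n → Vecℤ n → Set
InL A u = ∀ j → Σℤ (λ i → A j i * u i) ≡ + 0

LinDep : ∀ {n k} → (Fin k → Vecℤ n) → Set
LinDep {n} {k} v =
  Σ (Fin k → ℤ) λ c → (∃ λ j → c j ≢ + 0) × (∀ i → Σℤ (λ j → c j * v j i) ≡ + 0)

RankTwo : ∀ {d n} → Mat d n → Set
RankTwo {d} {n} A =
  (Σ (Vecℤ n) λ u → Σ (Vecℤ n) λ v → InL A u × InL A v × ¬ LinDep (pair u v))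
  × (∀ u v w → InL A u → InL A v → InL A w → LinDep (triple u v w))
  where
  pair : Vecℤ n → Vecℤ n → Fin 2 → Vecℤ n
  pair u v zero = u
  pair u v (suc _) = v
  triple : Vecℤ n → Vecℤ n → Vecℤ n → Fin 3 → Vecℤ n
  triple u v w zero = u
  triple u v w (suc zero) = v
  triple u v w (suc (suc _)) = w

PositiveFree : ∀ {d n} → Mat d n → Set
PositiveFree {d} {n} A =
  ∀ u → InL A u → (∀ i → + 0 ≤ u i) → ∀ i → u i ≡ + 0

InFiber : ∀ {d n} → Mat d n → Exp n → Exp n → Set
InFiber A u v = InL A (λ i → + u i - + v i)

-- v is NOT a vertex of P_v = conv(fiber of v): v is a convex combination
-- (rational weights, denominators cleared: natural weights λ with positive
-- total s, and Σ λ_j w_j = s·v) of points w_j of the fiber different from v.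
NotVertex : ∀ {d n} → Mat d n → Exp n → Set
NotVertex {d} {n} A v =
  Σ ℕ λ m → Σ (Fin m → Exp n) λ w → Σ (Fin m → ℕ) λ lam →
    (∀ j → InFiber A v (w j))
    × (∀ j → ∃ λ i → w j i ≢ v i)
    × (0 ℕ.< Σℕ lam)
    × (∀ i → Σℕ (λ j → lam j ℕ.* w j i) ≡ Σℕ lam ℕ.* v i)

-- Monomial ideals of k[x_1..x_n], given by their set of exponent vectors.
MonIdeal : ℕ → Set₁
MonIdeal n = Exp n → Set

-- The vertex ideal V_L: generated by x^v with v not a vertex of P_v,
-- so x^u ∈ V_L iff x^v ∣ x^u for such a v.
VL : ∀ {d n} → Mat d n → MonIdeal n
VL {d} {n} A u = Σ (Exp n) λ v → NotVertex A v × (∀ i → v i ℕ.≤ u i)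

-- x^u ∈ P_τ = ⟨ x_i : i ∉ τ ⟩
InP : ∀ {n} → Subset n → Exp n → Set
InP τ u = ∃ λ i → i ∉ τ × 0 ℕ.< u i

-- P_τ is an associated prime of the monomial ideal M:
-- P_τ = (M : x^w) for some monomial x^w.
IsAssoc : ∀ {n} → MonIdeal n → Subset n → Set
IsAssoc {n} M τ = Σ (Exp n) λ w → ∀ u → M (λ i → u i ℕ.+ w i) ⇔ InP τ u

-- P_τ is an embedded prime: associated and strictly containing another
-- associated prime P_σ (i.e. τ ⊊ σ).
IsEmbedded : ∀ {n} → MonIdeal n → Subset n → Set
IsEmbedded {n} M τ =
  IsAssoc M τ × (Σ (Subset n) λ σ → IsAssoc M σ × τ ⊆ σ × (∃ λ i → i ∈ σ × i ∉ τ))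

-- The integer point x lies in cone{a_i : i ∈ τ}: m·x = Σ_{i∈τ} λ_i a_i
-- with m > 0, λ_i ∈ ℕ.
InCone : ∀ {d n} → Mat d n → Subset n → Vecℤ d → Set
InCone {d} {n} A τ x =
  Σ ℕ λ m → Σ (Fin n → ℕ) λ lam →
    (0 ℕ.< m) × (∀ i → i ∉ τ → lam i ≡ 0)
    × (∀ j → + m * x j ≡ Σℤ (λ i → + lam i * A j i))

IsFace : ∀ {d n} → Mat d n → Subset n → Set
IsFace {d} {n} A τ =
  Σ (Vecℤ d) λ c →
    (∀ i → + 0 ≤ Σℤ (λ j → c j * A j i))
    × (∀ x → InCone A τ x ⇔ (InCone A Data.Fin.Subset.⊤ x × Σℤ (λ j → c j * x j) ≡ + 0))

{-# OPTIONS --safe #-}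
module Submission where

open import Defs
open import Data.Nat using (ℕ)
open import Data.Fin.Subset using (Subset) renaming (⊥ to ∅)
open import Data.Product using (_×_)
open import Relation.Nullary using (¬_)
open import Data.Empty using (⊥; ⊥-elim)
open import Data.Fin using (Fin; zero; suc; _≟_)
import Data.Fin.Properties as Fin
open import Data.Fin.Subset using (_∈_; _∉_) renaming (⊤ to full)
open import Data.Fin.Subset.Properties using (_∈?_; ∉⊥; ∈⊤)
open import Data.Integer using (ℤ; +_; -[1+_]; -_; _+_; _-_; _*_; _≤_; +≤+; ∣_∣)
import Data.Integer as ℤ
open import Data.Integer.DivMod using (_%ℕ_; _/ℕ_; n%ℕd<d; a≡a%ℕn+[a/ℕn]*n)
import Data.Integer.Properties as ℤ
open import Data.Integer.Tactic.RingSolver using (solve; solve-∀)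
open import Data.List using ([]; _∷_)
open import Data.Nat as ℕ using (z≤n; s≤s)
import Data.Nat.Properties as ℕ
open import Data.Product using (∃; _,_; proj₁; proj₂)
open import Data.Sum using (_⊎_; inj₁; inj₂; reduce)
import Data.Vec.Functional as Vector
open import Function using (id)
open import Function.Bundles using (_⇔_; Equivalence)
open import Relation.Binary.PropositionalEquality
open import Relation.Nullary using (Dec; yes; no)
open import Relation.Nullary.Decidable using (_×-dec_; ¬?)

-- The condition P_τ = (V : x^w) lives in the plane: with C the complement of τ, the origin is a
-- vertex of the lattice points of the polygon Q = { l ∈ L : l_k ≤ w_k for k ∈ C }, but stops
-- being one when any single constraint i ∈ C is relaxed by 1.  The core is that such a polygon
-- has a recession direction: some g ∈ L has g_k < 0 for every k ∈ C.
--
-- Relaxing i puts the origin on a segment or in a triangle of lattice points of the relaxed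
-- polygon.  A triangle of minimal area is p, q, r = − p − q with p, q a basis of L, unless an
-- opposite pair ±h appears.  If for some i no opposite pair exists, the constraints violated by − p and − q
-- confine all lattice points to cone(p,q) and the ray of r, and g = p + q works.  Otherwise every
-- i ∈ C has h_i ∈ Q such that − h_i violates the constraint i alone, by 1; then g is the sum of
-- the two angularly extreme h_i.
--
-- For τ = ∅ this g contradicts L ∩ ℕⁿ = 0.  If cone(a_i : i ∈ τ) is a face cut out by c, then
-- Σ g_i (c · a_i) = 0 forces c · a_i = 0 for all i, so every a_i lies in cone(a_j : j ∈ τ) and
-- each i ∉ τ yields a vector of L that is nonzero at i and vanishes elsewhere outside τ.
-- An associated P_σ has at least two indices outside σ, so an embedded P_τ has three outside τ,
-- and L would have rank three.  All conclusions are negative, so classical reasoning under ¬¬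
-- suffices.

-- Linear and polynomial inequalities

-- Every inequality is kept in the form 0 ≤ e (a < b being 0 ≤ b − a − 1), so that a consequence
-- is a sum of products of hypotheses followed by a ring identity.
infixl 6 _⊕_
infixl 7 _⊗_
infixl 5 _by_

_⊕_ : ∀ {a b} → + 0 ≤ a → + 0 ≤ b → + 0 ≤ a + b
_⊕_ = ℤ.+-mono-≤

_⊗_ : ∀ {a b} → + 0 ≤ a → + 0 ≤ b → + 0 ≤ a * b
_⊗_ {+ a} {+ b} _ _ = subst (+ 0 ≤_) (ℤ.pos-* a b) (+≤+ z≤n)

_by_ : ∀ {a b} → + 0 ≤ a → a ≡ b → + 0 ≤ b
p by q = subst (+ 0 ≤_) q p

either : ∀ {A B C : Set} → A ⊎ B → (A → C) → (B → C) → C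
either (inj₁ a) f g = f a
either (inj₂ b) f g = g b

0≤0 : + 0 ≤ + 0
0≤0 = +≤+ z≤n

0≤1 : + 0 ≤ + 1
0≤1 = +≤+ z≤n

≡⇒0≤ : ∀ {a b} → a ≡ b → + 0 ≤ b - a
≡⇒0≤ {a} refl = 0≤0 by solve (a ∷ [])

absurd : ∀ {a} → + 0 ≤ a → a ≡ - (+ 1) → ⊥
absurd p refl with () ← p

≤-or-> : ∀ a b → + 0 ≤ b - a ⊎ + 0 ≤ a - b - + 1
≤-or-> a b with a ℤ.≤? b
... | yes a≤b = inj₁ (ℤ.i≤j⇒0≤j-i a≤b)
... | no a≰b = inj₂ (ℤ.i≤j⇒0≤j-i (ℤ.i<j⇒suc[i]≤j (ℤ.≰⇒> a≰b)) by rearrange a b)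
  where
  rearrange : ∀ a b → a - (+ 1 + b) ≡ a - b - + 1
  rearrange = solve-∀

sign : ∀ a → + 0 ≤ a ⊎ + 0 ≤ - a - + 1
sign a with ≤-or-> (+ 0) a
... | inj₁ h = inj₁ (h by solve (a ∷ []))
... | inj₂ h = inj₂ (h by solve (a ∷ []))

≢0⇒≥1 : ∀ a → + 0 ≤ a → a ≢ + 0 → + 0 ≤ a - + 1
≢0⇒≥1 (+ ℕ.zero) _ a≢0 = ⊥-elim (a≢0 refl)
≢0⇒≥1 (+ ℕ.suc a) _ _ = +≤+ z≤n

≥1⇒≢0 : ∀ {a} → + 0 ≤ a - + 1 → a ≢ + 0
≥1⇒≢0 h refl = absurd h refl

≥1⇒≥0 : ∀ a → + 0 ≤ a - + 1 → + 0 ≤ a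
≥1⇒≥0 a h = h ⊕ 0≤1 by solve (a ∷ [])

antisym₀ : ∀ a → + 0 ≤ a → + 0 ≤ - a → a ≡ + 0
antisym₀ a h h' = ℤ.≤-antisym (ℤ.0≤i-j⇒j≤i (h' by solve (a ∷ []))) h

*-cancel-0≤ : ∀ d a → + 0 ≤ d - + 1 → + 0 ≤ d * a → + 0 ≤ a
*-cancel-0≤ d a hd h =
  either (sign a) id λ r → ⊥-elim (absurd (h ⊕ hd ⊗ r ⊕ r ⊕ hd) (solve (d ∷ a ∷ [])))

*-cancel-≡0 : ∀ {d a} → d ≢ + 0 → d * a ≡ + 0 → a ≡ + 0
*-cancel-≡0 {d} {a} d≢0 h with ℤ.i*j≡0⇒i≡0∨j≡0 d {a} h
... | inj₁ e = ⊥-elim (d≢0 e)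
... | inj₂ e = e

*-≥1 : ∀ a b → + 0 ≤ a - + 1 → + 0 ≤ b - + 1 → + 0 ≤ a * b - + 1
*-≥1 a b g h = g ⊗ h ⊕ g ⊕ h by solve (a ∷ b ∷ [])

square≥1 : ∀ a → a ≢ + 0 → + 0 ≤ a * a - + 1
square≥1 a a≢0 = either (sign a)
  (λ h → *-≥1 a a (≢0⇒≥1 a h a≢0) (≢0⇒≥1 a h a≢0))
  (λ g → g ⊗ g ⊕ g ⊕ g by solve (a ∷ []))

euclid : ∀ a d → + 0 ≤ d - + 1 →
  ∃ λ r → ∃ λ m → + 0 ≤ r × + 0 ≤ d - r - + 1 × a ≡ r + m * d
euclid a (+ ℕ.suc d) _ =
  + (a %ℕ ℕ.suc d) , a /ℕ ℕ.suc d , +≤+ z≤n ,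
  (ℤ.i≤j⇒0≤j-i (ℤ.i<j⇒suc[i]≤j (ℤ.+<+ (n%ℕd<d a (ℕ.suc d)))) by rearrange (+ ℕ.suc d) (+ (a %ℕ ℕ.suc d))) ,
  a≡a%ℕn+[a/ℕn]*n a (ℕ.suc d)
  where
  rearrange : ∀ d r → d - (+ 1 + r) ≡ d - r - + 1
  rearrange = solve-∀
euclid a (+ ℕ.zero) h = ⊥-elim (absurd h refl)
euclid a (-[1+ d ]) ()

-- Finite sums and choices

Σℤ-cong : ∀ {m} {f g : Fin m → ℤ} → (∀ j → f j ≡ g j) → Σℤ f ≡ Σℤ g
Σℤ-cong {ℕ.zero} h = refl
Σℤ-cong {ℕ.suc m} h = cong₂ _+_ (h zero) (Σℤ-cong (λ j → h (suc j)))

Σℤ-0 : ∀ m → Σℤ {m} (λ _ → + 0) ≡ + 0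
Σℤ-0 ℕ.zero = refl
Σℤ-0 (ℕ.suc m) = trans (ℤ.+-identityˡ _) (Σℤ-0 m)

Σℤ-linear : ∀ {m} a b (f g : Fin m → ℤ) →
  Σℤ (λ j → a * f j + b * g j) ≡ a * Σℤ f + b * Σℤ g
Σℤ-linear {ℕ.zero} a b f g = solve (a ∷ b ∷ [])
Σℤ-linear {ℕ.suc m} a b f g =
  trans (cong (λ x → a * f zero + b * g zero + x) (Σℤ-linear a b (λ j → f (suc j)) (λ j → g (suc j))))
    (step a b (f zero) (g zero) (Σℤ (λ j → f (suc j))) (Σℤ (λ j → g (suc j))))
  where
  step : ∀ a b x y F G → a * x + b * y + (a * F + b * G) ≡ a * (x + F) + b * (y + G)
  step = solve-∀

Σℤ-scale : ∀ {m} a (f : Fin m → ℤ) → Σℤ (λ j → a * f j) ≡ a * Σℤ f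
Σℤ-scale {ℕ.zero} a f = solve (a ∷ [])
Σℤ-scale {ℕ.suc m} a f =
  trans (cong (λ x → a * f zero + x) (Σℤ-scale a (λ j → f (suc j))))
    (sym (ℤ.*-distribˡ-+ a (f zero) (Σℤ (λ j → f (suc j)))))

Σℤ-+ : ∀ {m} (f g : Fin m → ℤ) → Σℤ (λ j → f j + g j) ≡ Σℤ f + Σℤ g
Σℤ-+ f g =
  trans (Σℤ-cong (λ j → sym (unit (f j) (g j)))) (trans (Σℤ-linear (+ 1) (+ 1) f g) (unit (Σℤ f) (Σℤ g)))
  where
  unit : ∀ a b → + 1 * a + + 1 * b ≡ a + b
  unit = solve-∀

Σℤ-swap : ∀ {m k} (f : Fin m → Fin k → ℤ) →
  Σℤ (λ i → Σℤ (λ j → f i j)) ≡ Σℤ (λ j → Σℤ (λ i → f i j))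
Σℤ-swap {ℕ.zero} {k} f = sym (Σℤ-0 k)
Σℤ-swap {ℕ.suc m} f =
  trans (cong (λ x → Σℤ (f zero) + x) (Σℤ-swap (λ i → f (suc i))))
    (sym (Σℤ-+ (f zero) (λ j → Σℤ (λ i → f (suc i) j))))

Σℤ-nonneg : ∀ {m} (f : Fin m → ℤ) → (∀ j → + 0 ≤ f j) → + 0 ≤ Σℤ f
Σℤ-nonneg {ℕ.zero} f h = 0≤0
Σℤ-nonneg {ℕ.suc m} f h = h zero ⊕ Σℤ-nonneg (λ j → f (suc j)) (λ j → h (suc j))

term≤Σℤ : ∀ {m} (f : Fin m → ℤ) → (∀ j → + 0 ≤ f j) → ∀ j → + 0 ≤ Σℤ f - f j
term≤Σℤ {ℕ.suc m} f h zero = Σℤ-nonneg (λ j → f (suc j)) (λ j → h (suc j)) by rearrange (f zero) (Σℤ (λ j → f (suc j)))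
  where
  rearrange : ∀ a b → b ≡ a + b - a
  rearrange = solve-∀
term≤Σℤ {ℕ.suc m} f h (suc j) = h zero ⊕ term≤Σℤ (λ j → f (suc j)) (λ j → h (suc j)) j
  by rearrange (f zero) (Σℤ (λ j → f (suc j))) (f (suc j))
  where
  rearrange : ∀ a b c → a + (b - c) ≡ a + b - c
  rearrange = solve-∀

zero-terms : ∀ {m} (f : Fin m → ℤ) → (∀ j → + 0 ≤ f j) → Σℤ f ≡ + 0 → ∀ j → f j ≡ + 0
zero-terms f h e j = antisym₀ (f j) (h j) (term≤Σℤ f h j by trans (cong (_- f j) e) (ℤ.+-identityˡ _))

least : ∀ {m} {P : Fin m → Set} (P? : ∀ i → Dec (P i)) (R : Fin m → Fin m → Set) →
  (∀ i j → P i → P j → R i j ⊎ R j i) →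
  (∀ i j k → P i → P j → P k → R i j → R j k → R i k) →
  ∃ P → ∃ λ i → P i × (∀ j → P j → R i j)
least {ℕ.zero} P? R tot tra (() , _)
least {ℕ.suc m} P? R tot tra witness with P? zero | Fin.any? (λ i → P? (suc i))
least P? R tot tra (zero , P0) | no ¬P0 | no ¬Ps = ⊥-elim (¬P0 P0)
least P? R tot tra (suc i , Pi) | no ¬P0 | no ¬Ps = ⊥-elim (¬Ps (i , Pi))
... | yes P0 | no ¬Ps = zero , P0 , λ where
  zero _ → reduce (tot zero zero P0 P0)
  (suc j) Pj → ⊥-elim (¬Ps (j , Pj))
... | P0? | yes Ps with least (λ i → P? (suc i)) (λ i j → R (suc i) (suc j))
                          (λ i j → tot (suc i) (suc j)) (λ i j k → tra (suc i) (suc j) (suc k)) Ps | P0?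
... | i , Pi , min | no ¬P0 = suc i , Pi , λ where
  zero P0 → ⊥-elim (¬P0 P0)
  (suc j) Pj → min j Pj
... | i , Pi , min | yes P0 with tot zero (suc i) P0 Pi
... | inj₁ r = zero , P0 , λ where
  zero _ → reduce (tot zero zero P0 P0)
  (suc j) Pj → tra zero (suc i) (suc j) P0 Pi Pj r (min j Pj)
... | inj₂ r = suc i , Pi , λ where
  zero _ → r
  (suc j) Pj → min j Pj

-- The index set is finite and the goal is ⊥, so the witnesses can be extracted one index at a time.
¬¬-choice : ∀ {m} {B : Set} (T : Fin m → B → Set) → (∀ i → ¬ ¬ ∃ (T i)) →
  ¬ ¬ ∃ λ (h : Fin m → B) → ∀ i → T i (h i)
¬¬-choice {ℕ.zero} T all k = k ((λ ()) , λ ())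
¬¬-choice {ℕ.suc m} T all k = all zero λ (b , tb) →
  ¬¬-choice (λ i → T (suc i)) (λ i → all (suc i)) λ (h , th) →
    k (b Vector.∷ h , λ { zero → tb ; (suc i) → th i })

decide : ∀ {A C : Set} → Dec A → (A → C) → (¬ A → C) → C
decide (yes a) f g = f a
decide (no ¬a) f g = g ¬a

-- Area and minimal triangles

neg : ∀ {n} → Vecℤ n → Vecℤ n
neg p k = - p k

Nonzero : ∀ {n} → Vecℤ n → Set
Nonzero p = ∃ λ k → p k ≢ + 0

-- A witness that the origin lies in the convex hull of S.
record Relation {n} (S : Vecℤ n → Set) : Set where
  field
    {size} : ℕ
    pt : Fin size → Vecℤ n
    wt : Fin size → ℤ
    wt≥0 : ∀ j → + 0 ≤ wt j
    heavy : ∃ λ j → + 0 ≤ wt j - + 1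
    pt∈ : ∀ j → S (pt j)
    balanced : ∀ k → Σℤ (λ j → wt j * pt j k) ≡ + 0

  linear-balanced : ∀ a b x y → Σℤ (λ j → wt j * (a * pt j x + b * pt j y)) ≡ + 0
  linear-balanced a b x y =
    trans (Σℤ-cong (λ j → distribute (wt j) a b (pt j x) (pt j y)))
    (trans (Σℤ-linear a b (λ j → wt j * pt j x) (λ j → wt j * pt j y))
    (trans (cong₂ (λ X Y → a * X + b * Y) (balanced x) (balanced y)) (collapse a b)))
    where
    distribute : ∀ w a b X Y → w * (a * X + b * Y) ≡ a * (w * X) + b * (w * Y)
    distribute = solve-∀
    collapse : ∀ a b → a * + 0 + b * + 0 ≡ + 0
    collapse = solve-∀

  -- A point of weight zero contributes nothing, so `f` has to be controlled only on the support of
  -- the weights.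
  weighted≥0 : (f : Fin size → ℤ) → (∀ j → + 0 ≤ wt j - + 1 → + 0 ≤ f j) → ∀ j → + 0 ≤ wt j * f j
  weighted≥0 f h j = either (sign (wt j - + 1))
    (λ w → wt≥0 j ⊗ h j w)
    (λ w → 0≤0 by sym (cong (_* f j) (antisym₀ (wt j) (wt≥0 j) (w by lightest (wt j)))))
    where
    lightest : ∀ w → - (w - + 1) - + 1 ≡ - w
    lightest = solve-∀

  -- The weighted values add up to zero, so nonnegative ones all vanish, which fails at the heavy
  -- point. Two coordinates express both kinds of functional in use: `ω` against fixed vectors, and
  -- one coordinate (with `x` and `y` equal).
  ¬positive-functional : ∀ a b x y →
    (∀ j → + 0 ≤ wt j - + 1 → + 0 ≤ a * pt j x + b * pt j y - + 1) → ⊥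
  ¬positive-functional a b x y h =
    ≥1⇒≢0 (*-≥1 (wt j₀) (f j₀) w₀ (h j₀ w₀))
      (zero-terms (λ j → wt j * f j)
        (weighted≥0 f (λ j w → ≥1⇒≥0 (f j) (h j w)))
        (linear-balanced a b x y) j₀)
    where
    f : Fin size → ℤ
    f j = a * pt j x + b * pt j y
    j₀ = proj₁ heavy
    w₀ = proj₂ heavy

-- `z` lies in the triangle `0`, `p`, `q` with barycentric weights `d - a - b`, `a`, `b` over `d`;
-- at the origin the bound is `0 ≤ B`.
convex-bound : ∀ d a b z p q B → + 0 ≤ d - + 1 → + 0 ≤ a → + 0 ≤ b → + 0 ≤ d - a - b →
  d * z ≡ a * p + b * q → + 0 ≤ B → + 0 ≤ B - p → + 0 ≤ B - q → + 0 ≤ B - z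
convex-bound d a b z p q B hd ha hb hc e hB hp hq =
  *-cancel-0≤ d (B - z) hd
    (ha ⊗ hp ⊕ hb ⊗ hq ⊕ hc ⊗ hB ⊕ ≡⇒0≤ e by solve (d ∷ a ∷ b ∷ z ∷ p ∷ q ∷ B ∷ []))

δ : ∀ {n} → Fin n → Exp n
δ i k = decide (i ≟ k) (λ _ → 1) (λ _ → 0)

δ-self : ∀ {n} (i : Fin n) → δ i i ≡ 1
δ-self i with i ≟ i
... | yes _ = refl
... | no i≢i = ⊥-elim (i≢i refl)

δ-other : ∀ {n} {i k : Fin n} → i ≢ k → δ i k ≡ 0
δ-other {i = i} {k} i≢k with i ≟ k
... | yes i≡k = ⊥-elim (i≢k i≡k)
... | no _ = refl

-- The area form of a rank-two lattice

module Lattice {n : ℕ} (L : Vecℤ n → Set)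
  (L-resp : ∀ {p q} → (∀ k → p k ≡ q k) → L p → L q)
  (L-comb : ∀ a b {p q} → L p → L q → L (λ k → a * p k + b * q k))
  (s t : Fin n) where

  -- A minor in two fixed coordinates; on a rank-two lattice where it is not identically zero, it is
  -- the area form up to a factor.
  ω : Vecℤ n → Vecℤ n → ℤ
  ω p q = p s * q t - p t * q s

  module RankTwoLattice
    (cramer : ∀ {p q r} → L p → L q → L r → ∀ k → ω q r * p k + ω r p * q k + ω p q * r k ≡ + 0)
    {u v : Vecℤ n} (Lu : L u) (Lv : L v) (ωuv≢0 : ω u v ≢ + 0)
    {C : Fin n → Set} (C? : ∀ k → Dec (C k)) where

    L-neg : ∀ {p} → L p → L (neg p)
    L-neg {p} Lp = L-resp (λ k → eq (p k)) (L-comb (- + 1) (+ 0) Lp Lp)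
      where
      eq : ∀ a → (- + 1) * a + + 0 * a ≡ - a
      eq = solve-∀

    ω-flip : ∀ p q → ω q p ≡ - ω p q
    ω-flip p q = eq (p s) (p t) (q s) (q t)
      where
      eq : ∀ a b c d → c * b - d * a ≡ - (a * d - b * c)
      eq = solve-∀

    ω≢0⇒nonzeroˡ : ∀ p q → ω p q ≢ + 0 → Nonzero p
    ω≢0⇒nonzeroˡ p q h with p s ℤ.≟ + 0 | p t ℤ.≟ + 0
    ... | no ps≢0 | _ = s , ps≢0
    ... | yes _ | no pt≢0 = t , pt≢0
    ... | yes ps≡0 | yes pt≡0 = ⊥-elim (h (cong₂ (λ a b → a * q t - b * q s) ps≡0 pt≡0))

    ω≢0⇒nonzeroʳ : ∀ p q → ω p q ≢ + 0 → Nonzero q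
    ω≢0⇒nonzeroʳ p q h = ω≢0⇒nonzeroˡ q p λ e → h (trans (ω-flip q p) (cong -_ e))

    nondegenerate : ∀ {p} → L p → Nonzero p → ∃ λ x → L x × ω p x ≢ + 0
    nondegenerate {p} Lp (k , pk≢0) with ω p u ℤ.≟ + 0 | ω p v ℤ.≟ + 0
    ... | no pu≢0 | _ = u , Lu , pu≢0
    ... | yes _ | no pv≢0 = v , Lv , pv≢0
    ... | yes pu≡0 | yes pv≡0 = ⊥-elim (pk≢0 (*-cancel-≡0 {ω u v} ωuv≢0
      (trans (sym (trans (cong₂ (λ a b → ω u v * p k + a * u k + b * v k)
                           (trans (ω-flip p v) (cong -_ pv≡0)) pu≡0)
                         (collapse (ω u v * p k) (u k) (v k))))
             (cramer Lp Lu Lv k))))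
      where
      collapse : ∀ a b c → a + + 0 * b + + 0 * c ≡ a
      collapse = solve-∀

    parallel : ∀ {p q x} → L p → L q → L x → ω p q ≡ + 0 → ∀ k → ω q x * p k ≡ ω p x * q k
    parallel {p} {q} {x} Lp Lq Lx pq≡0 k =
      trans (rearrange (ω q x * p k) (ω p x) (q k) (x k))
      (trans (cong (_+ ω p x * q k) (trans (cong₂ (λ a b → ω q x * p k + a * q k + b * x k)
                                              (sym (ω-flip p x)) (sym pq≡0))
                                           (cramer Lp Lq Lx k)))
             (ℤ.+-identityˡ (ω p x * q k)))
      where
      rearrange : ∀ a b c d → a ≡ a + (- b) * c + + 0 * d + b * c
      rearrange = solve-∀

    -- In the Gale dual picture p_k is ⟨b_k , p⟩, so that this is a polygon without the origin.
    Body : Vecℤ n → Vecℤ n → Set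
    Body B p = L p × Nonzero p × (∀ k → C k → + 0 ≤ B k - p k)

    NonNegative : Vecℤ n → Set
    NonNegative B = ∀ k → C k → + 0 ≤ B k

    Nonzero-neg : ∀ {p : Vecℤ n} → Nonzero p → Nonzero (neg p)
    Nonzero-neg {p} (k , pk≢0) = k , λ e → pk≢0 (trans (sym (ℤ.neg-involutive (p k))) (cong -_ e))

    NoOpposite : Vecℤ n → Set
    NoOpposite B = ∀ {p} → Body B p → Body B (neg p) → ⊥

    larger≥1 : ∀ x y → + 0 ≤ y - x → + 0 ≤ x + y - + 1 → + 0 ≤ y - + 1
    larger≥1 x y h g = either (sign (y - + 1)) id
      (λ r → ⊥-elim (absurd (h ⊕ g ⊕ r ⊕ r) (solve (x ∷ y ∷ []))))

    -- `- r` is `x / y` times `q`, a point of the segment from the origin to `q`, and the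
    -- constraints hold at both ends.
    opposite-in-body : ∀ {B q r} → NonNegative B → Body B q → Body B r → ∀ x y →
      + 0 ≤ x → + 0 ≤ y - x → + 0 ≤ y - + 1 → (∀ k → x * q k + y * r k ≡ + 0) → Body B (neg r)
    opposite-in-body {B} {q} {r} B≥0 (Lq , _ , hq) (Lr , r≢0 , hr) x y hx hxy hy e =
      L-neg Lr , Nonzero-neg r≢0 , λ k Ck →
        convex-bound y x (+ 0) (- r k) (q k) (q k) (B k) hy hx 0≤0
          (hxy by solve (x ∷ y ∷ []))
          (trans (rearrange x y (q k) (r k)) (trans (cong (λ a → x * q k + + 0 * q k - a) (e k)) (ℤ.+-identityʳ _)))
          (B≥0 k Ck) (hq k Ck) (hq k Ck)
      where
      rearrange : ∀ x y q r → y * - r ≡ x * q + + 0 * q - (x * q + y * r)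
      rearrange = solve-∀

    -- The vector with the larger coefficient is the shorter one, so its negative lies between the
    -- origin and the other vector.
    ¬opposite-rays : ∀ {B q r} → NonNegative B → NoOpposite B → Body B q → Body B r → ∀ x y →
      + 0 ≤ x → + 0 ≤ y → + 0 ≤ x + y - + 1 → (∀ k → x * q k + y * r k ≡ + 0) → ⊥
    ¬opposite-rays {B} {q} {r} B≥0 noOpp bq br x y hx hy hxy e = either (≤-or-> x y)
      (λ x≤y → noOpp br (opposite-in-body B≥0 bq br x y hx x≤y (larger≥1 x y x≤y hxy) e))
      (λ y<x → noOpp bq (opposite-in-body B≥0 br bq y x hy (y<x ⊕ 0≤1 by solve (x ∷ y ∷ []))
         (larger≥1 y x (y<x ⊕ 0≤1 by solve (x ∷ y ∷ [])) (hxy by solve (x ∷ y ∷ [])))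
         λ k → trans (ℤ.+-comm (y * r k) (x * q k)) (e k)))

    -- If `X * Y` were at most 0, the combination of `q` and `p` with coefficients `X * X` and
    -- `- (X * Y)`, zero by `parallel`, would put them on opposite rays.
    same-side : ∀ {B p q x} → NonNegative B → NoOpposite B → Body B p → Body B q → L x →
      ω p x ≢ + 0 → ω p q ≡ + 0 → + 0 ≤ ω p x * ω q x - + 1
    same-side {B} {p} {q} {x} B≥0 noOpp bp bq Lx X≢0 pq≡0 =
      either {C = + 0 ≤ X * Y - + 1} (sign (X * Y - + 1)) id λ h → ⊥-elim
        (¬opposite-rays B≥0 noOpp bq bp (X * X) (- (X * Y))
          (≥1⇒≥0 (X * X) (square≥1 X X≢0))
          (h by negative X Y)
          (square≥1 X X≢0 ⊕ h by regroup X Y)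
          λ k → trans (cancels X Y (p k) (q k))
            (trans (cong (λ b → X * (X * q k) - X * b) (parallel (proj₁ bp) (proj₁ bq) Lx pq≡0 k))
                   (ℤ.+-inverseʳ (X * (X * q k)))))
      where
      X = ω p x
      Y = ω q x
      negative : ∀ X Y → - (X * Y - + 1) - + 1 ≡ - (X * Y)
      negative = solve-∀
      regroup : ∀ X Y → X * X - + 1 + (- (X * Y - + 1) - + 1) ≡ X * X + - (X * Y) - + 1
      regroup = solve-∀
      cancels : ∀ X Y a l → X * X * l + - (X * Y) * a ≡ X * (X * l) - X * (Y * a)
      cancels = solve-∀

    -- An area rather than a length: the determinant of `q - p` and `r - p`, twice the signed area
    -- of the triangle in the coordinates `s` and `t`.
    perimeter : Vecℤ n → Vecℤ n → Vecℤ n → ℤ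
    perimeter p q r = ω q r + ω r p + ω p q

    -- With these signs `cramer` is a convex relation, so the origin lies in the closed triangle,
    -- possibly on an edge.
    record Triangle (B p q r : Vecℤ n) : Set where
      constructor triangle
      field
        p∈ : Body B p
        q∈ : Body B q
        r∈ : Body B r
        qr : + 0 ≤ ω q r
        rp : + 0 ≤ ω r p
        pq : + 0 ≤ ω p q
        proper : + 0 ≤ perimeter p q r - + 1

    module _ {B} (B≥0 : NonNegative B) (noOpp : NoOpposite B)
             (noTri : ∀ {p q r} → Triangle B p q r → ⊥) where

      turn-total : ∀ p q → + 0 ≤ ω p q ⊎ + 0 ≤ ω q p
      turn-total p q = either (sign (ω p q)) inj₁
        λ h → inj₂ (≥1⇒≥0 (- ω p q) h by sym (ω-flip p q))

      -- If it failed, `p`, `q`, `r` would wind around the origin and form a triangle. So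
      -- `0 ≤ ω p q` is an angular preorder on the body.
      turn-trans : ∀ {p q r} → Body B p → Body B q → Body B r →
        + 0 ≤ ω p q → + 0 ≤ ω q r → + 0 ≤ ω p r
      turn-trans {p} {q} {r} bp bq br hpq hqr = either (sign (ω p r)) id λ h →
        ⊥-elim (noTri (triangle bp bq br hqr
          (≥1⇒≥0 (- ω p r) h by sym (ω-flip p r)) hpq
          (hqr ⊕ h ⊕ hpq by trans (regroup (ω q r) (ω p r) (ω p q))
            (cong (λ a → ω q r + a + ω p q - + 1) (sym (ω-flip p r))))))
        where
        regroup : ∀ a b c → a + (- b - + 1) + c ≡ a + - b + c - + 1
        regroup = solve-∀

      -- Let `a` be the angularly first point of positive weight. The values `ω a` at the points of
      -- positive weight are nonnegative with weighted sum zero, so these points are collinear with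
      -- `a`, and by `same-side` on one ray.
      ¬relation : Relation (Body B) → ⊥
      ¬relation R = conclude
        (least (λ j → + 0 ℤ.≤? wt j - + 1) (λ i j → + 0 ≤ ω (pt i) (pt j))
          (λ i j _ _ → turn-total (pt i) (pt j))
          (λ i j k _ _ _ → turn-trans (pt∈ i) (pt∈ j) (pt∈ k)) heavy)
        where
        open Relation R
        expandˡ : ∀ a b c d → a * d - b * c ≡ a * d + (- b) * c
        expandˡ = solve-∀
        expandʳ : ∀ X c d z₁ z₂ → X * (z₁ * d - z₂ * c) ≡ X * d * z₁ + - (X * c) * z₂
        expandʳ = solve-∀
        conclude : (∃ λ i → + 0 ≤ wt i - + 1 × (∀ j → + 0 ≤ wt j - + 1 → + 0 ≤ ω (pt i) (pt j))) → ⊥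
        conclude (i , _ , first) =
          -- The functional sends `z` to `X * ω z x`, with `x` off the line of `a`.
          ¬positive-functional (X * x t) (- (X * x s)) s t λ j w →
            same-side B≥0 noOpp (pt∈ i) (pt∈ j) (proj₁ (proj₂ ray)) (proj₂ (proj₂ ray)) (collinear j w)
              by cong (_- + 1) (expandʳ X (x s) (x t) (pt j s) (pt j t))
          where
          a = pt i
          La = proj₁ (pt∈ i)
          ray = nondegenerate La (proj₁ (proj₂ (pt∈ i)))
          x = proj₁ ray
          X = ω a x
          collinear : ∀ j → + 0 ≤ wt j - + 1 → ω a (pt j) ≡ + 0
          collinear j w = *-cancel-≡0 {wt j} (≥1⇒≢0 w)
            (zero-terms (λ j → wt j * ω a (pt j)) (weighted≥0 (λ j → ω a (pt j)) first)
              (trans (Σℤ-cong (λ j → cong (wt j *_) (expandˡ (a s) (a t) (pt j s) (pt j t))))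
                (linear-balanced (a s) (- a t) t s)) j)

    Smaller : Vecℤ n → ℤ → Set
    Smaller B N = ∃ λ p → ∃ λ q → ∃ λ r → Triangle B p q r × + 0 ≤ N - perimeter p q r - + 1

    SpannedBy : Vecℤ n → Vecℤ n → Vecℤ n → Set
    SpannedBy p q z = ∃ λ x → ∃ λ y → ∀ k → z k ≡ x * p k + y * q k

    rotate : ∀ {B p q r} → Triangle B p q r → Triangle B q r p
    rotate {B} {p} {q} {r} (triangle bp bq br qr rp pq proper) =
      triangle bq br bp rp pq qr (proper by cycle (ω q r) (ω r p) (ω p q))
      where
      cycle : ∀ a b c → a + b + c - + 1 ≡ b + c + a - + 1
      cycle = solve-∀

    decompose : ∀ {p q z} → L p → L q → L z → ∀ k → ω p q * z k ≡ ω z q * p k + ω p z * q k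
    decompose {p} {q} {z} Lp Lq Lz k =
      trans (rearrange (ω z q) (ω p z) (ω p q) (p k) (q k) (z k))
      (trans (cong (λ a → a + ω z q * p k + ω p z * q k)
               (trans (cong₂ (λ a b → a * p k + b * q k + ω p q * z k) (sym (ω-flip z q)) (sym (ω-flip p z)))
                      (cramer Lp Lq Lz k)))
             (cong (_+ ω p z * q k) (ℤ.+-identityˡ (ω z q * p k))))
      where
      rearrange : ∀ a b c p q z → c * z ≡ (- a) * p + (- b) * q + c * z + a * p + b * q
      rearrange = solve-∀

    -- The three-term Grassmann-Plücker relation.
    plücker : ∀ p q z r → ω p q * ω z r ≡ ω p z * ω q r - ω z q * ω r p
    plücker p q z r = eq (p s) (p t) (q s) (q t) (z s) (z t) (r s) (r t)
      where
      eq : ∀ p₁ p₂ q₁ q₂ z₁ z₂ r₁ r₂ → (p₁ * q₂ - p₂ * q₁) * (z₁ * r₂ - z₂ * r₁) ≡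
        (p₁ * z₂ - p₂ * z₁) * (q₁ * r₂ - q₂ * r₁) - (z₁ * q₂ - z₂ * q₁) * (r₁ * p₂ - r₂ * p₁)
      eq = solve-∀

    -- D, α, β are the three determinants of the triangle, a and b the coordinates of D z
    -- in p and q, and E decides on which side of the ray through z the vertex r lies.
    module _ (D α β a b E : ℤ) (hD : + 0 ≤ D - + 1) (hα : + 0 ≤ α) (hβ : + 0 ≤ β)
             (ha : + 0 ≤ a) (hb : + 0 ≤ b) (hDa : + 0 ≤ D - a - + 1) (hDb : + 0 ≤ D - b - + 1)
             (e : D * E ≡ b * α - a * β) where

      -- This is the replacement of `q` by `z`. By `e`, `D * (α - E)` equals `(D - b) * α + a * β`,
      -- so `E` is at most `α`, while `b` is strictly below `D`.
      perimeter-dropˡ : + 0 ≤ (α + β + D) - (E + β + b) - + 1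
      perimeter-dropˡ = *-cancel-0≤ D (α - E) hD
        (hDb ⊗ hα ⊕ hα ⊕ ha ⊗ hβ ⊕ ≡⇒0≤ e by solve (D ∷ α ∷ β ∷ a ∷ b ∷ E ∷ []))
        ⊕ hDb by solve (D ∷ α ∷ β ∷ a ∷ b ∷ E ∷ [])

      perimeter-dropʳ : + 0 ≤ (α + β + D) - (α + (- E) + a) - + 1
      perimeter-dropʳ = *-cancel-0≤ D (β + E) hD
        (hDa ⊗ hβ ⊕ hβ ⊕ hb ⊗ hα ⊕ ≡⇒0≤ (sym e) by solve (D ∷ α ∷ β ∷ a ∷ b ∷ E ∷ []))
        ⊕ hDa by solve (D ∷ α ∷ β ∷ a ∷ b ∷ E ∷ [])

    perimeter≥1 : ∀ a b c → + 0 ≤ a → + 0 ≤ b - + 1 → + 0 ≤ c → + 0 ≤ a + b + c - + 1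
    perimeter≥1 a b c ha hb hc = ha ⊕ hb ⊕ hc by solve (a ∷ b ∷ c ∷ [])

    perimeter≥1′ : ∀ a b c → + 0 ≤ a - + 1 → + 0 ≤ b → + 0 ≤ c → + 0 ≤ a + b + c - + 1
    perimeter≥1′ a b c ha hb hc = ha ⊕ hb ⊕ hc by solve (a ∷ b ∷ c ∷ [])

    -- `z` is a point of the triangle `0`, `p`, `q` other than its vertices. If `ω z r` is
    -- nonnegative it can replace `q`, otherwise `p`, and the new triangle still contains the
    -- origin.
    shrink-at : ∀ {B p q r z} → NonNegative B → Triangle B p q r →
      + 0 ≤ ω q r - + 1 → + 0 ≤ ω r p - + 1 → + 0 ≤ ω p q - + 1 →
      L z → + 0 ≤ ω z q → + 0 ≤ ω p z → ω z q ≢ + 0 ⊎ ω p z ≢ + 0 → + 0 ≤ ω p q - ω z q - ω p z →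
      + 0 ≤ ω p q - ω z q - + 1 → + 0 ≤ ω p q - ω p z - + 1 → Smaller B (perimeter p q r)
    shrink-at {B} {p} {q} {r} {z} B≥0 (triangle bp bq br qr rp pq _) hα hβ hD Lz ha hb nz hab hDa hDb =
      either (sign E)
        (λ h → p , z , r ,
          triangle bp z∈ br h rp hb (perimeter≥1 E (ω r p) (ω p z) h hβ hb) ,
          perimeter-dropˡ (ω p q) (ω q r) (ω r p) (ω z q) (ω p z) E hD qr rp ha hb hDa hDb (plücker p q z r))
        (λ h → z , q , r ,
          triangle z∈ bq br qr (≥1⇒≥0 (- E) h by sym (ω-flip z r)) ha
            (perimeter≥1′ (ω q r) (ω r z) (ω z q) hα (≥1⇒≥0 (- E) h by sym (ω-flip z r)) ha) ,
          (perimeter-dropʳ (ω p q) (ω q r) (ω r p) (ω z q) (ω p z) E hD qr rp ha hb hDa hDb (plücker p q z r)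
            by cong (λ x → perimeter p q r - (ω q r + x + ω z q) - + 1) (sym (ω-flip z r))))
      where
      E = ω z r
      z≢0 : Nonzero z
      z≢0 = either nz (ω≢0⇒nonzeroˡ z q) (ω≢0⇒nonzeroʳ p z)
      z∈ : Body B z
      z∈ = Lz , z≢0 , λ k Ck →
        convex-bound (ω p q) (ω z q) (ω p z) (z k) (p k) (q k) (B k) hD ha hb hab
          (decompose (proj₁ bp) (proj₁ bq) Lz k) (B≥0 k Ck) (proj₂ (proj₂ bp) k Ck) (proj₂ (proj₂ bq) k Ck)

    -- z reduced modulo p and q to the fundamental parallelogram, or its reflection p + q - z,
    -- lies in the triangle 0 p q.
    spanned-or-smaller : ∀ {B p q r z} → NonNegative B → Triangle B p q r →
      + 0 ≤ ω q r - + 1 → + 0 ≤ ω r p - + 1 → + 0 ≤ ω p q - + 1 →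
      L z → SpannedBy p q z ⊎ Smaller B (perimeter p q r)
    spanned-or-smaller {B} {p} {q} {r} {z} B≥0 T hα hβ hD Lz
      with euclid (ω z q) (ω p q) hD | euclid (ω p z) (ω p q) hD
    ... | a , m , ha , hDa , ea | b , l , hb , hDb , eb = reduceBy (a ℤ.≟ + 0) (b ℤ.≟ + 0)
      where
      open Triangle T
      Lp = proj₁ p∈
      Lq = proj₁ q∈
      z′ : Vecℤ n
      z′ k = + 1 * z k + + 1 * ((- m) * p k + (- l) * q k)
      Lz′ : L z′
      Lz′ = L-comb (+ 1) (+ 1) Lz (L-comb (- m) (- l) Lp Lq)
      z″ : Vecℤ n
      z″ k = + 1 * (+ 1 * p k + + 1 * q k) + (- + 1) * z′ k
      Lz″ : L z″
      Lz″ = L-comb (+ 1) (- + 1) (L-comb (+ 1) (+ 1) Lp Lq) Lz′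
      minus : ∀ a m D → a + m * D - m * D ≡ a
      minus = solve-∀
      z′q : ω z′ q ≡ a
      z′q = trans (eq m l (z s) (z t) (p s) (p t) (q s) (q t))
        (trans (cong (_- m * ω p q) ea) (minus a m (ω p q)))
        where
        eq : ∀ m l z₁ z₂ p₁ p₂ q₁ q₂ →
          (+ 1 * z₁ + + 1 * ((- m) * p₁ + (- l) * q₁)) * q₂ - (+ 1 * z₂ + + 1 * ((- m) * p₂ + (- l) * q₂)) * q₁
          ≡ (z₁ * q₂ - z₂ * q₁) - m * (p₁ * q₂ - p₂ * q₁)
        eq = solve-∀
      pz′ : ω p z′ ≡ b
      pz′ = trans (eq m l (z s) (z t) (p s) (p t) (q s) (q t))
        (trans (cong (_- l * ω p q) eb) (minus b l (ω p q)))
        where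
        eq : ∀ m l z₁ z₂ p₁ p₂ q₁ q₂ →
          p₁ * (+ 1 * z₂ + + 1 * ((- m) * p₂ + (- l) * q₂)) - p₂ * (+ 1 * z₁ + + 1 * ((- m) * p₁ + (- l) * q₁))
          ≡ (p₁ * z₂ - p₂ * z₁) - l * (p₁ * q₂ - p₂ * q₁)
        eq = solve-∀
      z″q : ω z″ q ≡ ω p q - a
      z″q = trans (eq (z′ s) (z′ t) (p s) (p t) (q s) (q t)) (cong (λ x → ω p q - x) z′q)
        where
        eq : ∀ z₁ z₂ p₁ p₂ q₁ q₂ →
          (+ 1 * (+ 1 * p₁ + + 1 * q₁) + (- + 1) * z₁) * q₂ - (+ 1 * (+ 1 * p₂ + + 1 * q₂) + (- + 1) * z₂) * q₁
          ≡ (p₁ * q₂ - p₂ * q₁) - (z₁ * q₂ - z₂ * q₁)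
        eq = solve-∀
      pz″ : ω p z″ ≡ ω p q - b
      pz″ = trans (eq (z′ s) (z′ t) (p s) (p t) (q s) (q t)) (cong (λ x → ω p q - x) pz′)
        where
        eq : ∀ z₁ z₂ p₁ p₂ q₁ q₂ →
          p₁ * (+ 1 * (+ 1 * p₂ + + 1 * q₂) + (- + 1) * z₂) - p₂ * (+ 1 * (+ 1 * p₁ + + 1 * q₁) + (- + 1) * z₁)
          ≡ (p₁ * q₂ - p₂ * q₁) - (p₁ * z₂ - p₂ * z₁)
        eq = solve-∀

      use : ∀ {y c d} → L y → ω y q ≡ c → ω p y ≡ d → + 0 ≤ c → + 0 ≤ d → c ≢ + 0 ⊎ d ≢ + 0 →
        + 0 ≤ ω p q - c - d → + 0 ≤ ω p q - c - + 1 → + 0 ≤ ω p q - d - + 1 → Smaller B (perimeter p q r)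
      use Ly refl refl hc hd nz hcd hDc hDd = shrink-at B≥0 T hα hβ hD Ly hc hd nz hcd hDc hDd

      -- The reflected point has coordinates `D - a` and `D - b`, which are strictly below `D` only
      -- if `a` and `b` are positive.
      reflectable : ∀ D a b → + 0 ≤ a + b - D - + 1 → + 0 ≤ D - b - + 1 → + 0 ≤ a - + 1
      reflectable D a b h g = h ⊕ g ⊕ 0≤1 by solve (D ∷ a ∷ b ∷ [])

      inside : a ≢ + 0 ⊎ b ≢ + 0 → Smaller B (perimeter p q r)
      inside nz = either (≤-or-> (a + b) (ω p q))
        (λ h → use Lz′ z′q pz′ ha hb nz (h by reorder (ω p q) a b) hDa hDb)
        (λ h → use Lz″ z″q pz″ (≥1⇒≥0 (ω p q - a) hDa) (≥1⇒≥0 (ω p q - b) hDb)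
          (inj₁ (≥1⇒≢0 hDa)) (h ⊕ 0≤1 by reflect (ω p q) a b)
          (reflectable (ω p q) a b h hDb by complement (ω p q) a)
          (reflectable (ω p q) b a (h by flip (ω p q) a b) hDa by complement (ω p q) b))
        where
        reorder : ∀ D a b → D - (a + b) ≡ D - a - b
        reorder = solve-∀
        reflect : ∀ D a b → a + b - D - + 1 + + 1 ≡ D - (D - a) - (D - b)
        reflect = solve-∀
        complement : ∀ D a → a - + 1 ≡ D - (D - a) - + 1
        complement = solve-∀
        flip : ∀ D a b → a + b - D - + 1 ≡ b + a - D - + 1
        flip = solve-∀

      spanned : a ≡ + 0 → b ≡ + 0 → SpannedBy p q z
      spanned a≡0 b≡0 = m , l , λ k →
        ℤ.i-j≡0⇒i≡j (z k) (m * p k + l * q k) (trans (shape m l (p k) (q k) (z k))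
          (*-cancel-≡0 {ω p q} (≥1⇒≢0 hD) (trans (decompose Lp Lq Lz′ k)
            (cong₂ (λ x y → x * p k + y * q k) (trans z′q a≡0) (trans pz′ b≡0)))))
        where
        shape : ∀ m l p q z → z - (m * p + l * q) ≡ + 1 * z + + 1 * ((- m) * p + (- l) * q)
        shape = solve-∀

      reduceBy : Dec (a ≡ + 0) → Dec (b ≡ + 0) → SpannedBy p q z ⊎ Smaller B (perimeter p q r)
      reduceBy (yes a≡0) (yes b≡0) = inj₁ (spanned a≡0 b≡0)
      reduceBy (no a≢0) _ = inj₂ (inside (inj₁ a≢0))
      reduceBy (yes _) (no b≢0) = inj₂ (inside (inj₂ b≢0))

    -- Unimodular triangles

    record Unimodular (B p q r : Vecℤ n) : Set where
      field
        p∈ : Body B p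
        q∈ : Body B q
        r∈ : Body B r
        centred : ∀ k → p k + q k + r k ≡ + 0
        oriented : + 0 ≤ ω p q - + 1
        basis : ∀ {z} → L z → SpannedBy p q z

    multiple-≥ : ∀ a b → + 0 ≤ a - + 1 → + 0 ≤ b - + 1 → (∃ λ c → a ≡ c * b) → + 0 ≤ a - b
    multiple-≥ a b ha hb (c , e) = either {C = + 0 ≤ a - b} (sign (c - + 1))
      (λ h → h ⊗ hb ⊕ h ⊕ ≡⇒0≤ (sym e) by solve (a ∷ b ∷ c ∷ []))
      (λ h → ⊥-elim (absurd (ha ⊕ h ⊗ hb ⊕ h ⊕ ≡⇒0≤ e) (solve (a ∷ b ∷ c ∷ []))))

    spanned-detˡ : ∀ {p q z} → SpannedBy p q z → ∃ λ c → ω q z ≡ c * ω p q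
    spanned-detˡ {p} {q} {z} (x , y , e) =
      - x , trans (cong₂ (λ a b → q s * a - q t * b) (e t) (e s)) (eq x y (p s) (p t) (q s) (q t))
      where
      eq : ∀ x y p₁ p₂ q₁ q₂ → q₁ * (x * p₂ + y * q₂) - q₂ * (x * p₁ + y * q₁) ≡ (- x) * (p₁ * q₂ - p₂ * q₁)
      eq = solve-∀

    spanned-detʳ : ∀ {p q z} → SpannedBy p q z → ∃ λ c → ω z p ≡ c * ω p q
    spanned-detʳ {p} {q} {z} (x , y , e) =
      - y , trans (cong₂ (λ a b → a * p t - b * p s) (e s) (e t)) (eq x y (p s) (p t) (q s) (q t))
      where
      eq : ∀ x y p₁ p₂ q₁ q₂ → (x * p₁ + y * q₁) * p₂ - (x * p₂ + y * q₂) * p₁ ≡ (- y) * (p₁ * q₂ - p₂ * q₁)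
      eq = solve-∀

    module _ {B} (B≥0 : NonNegative B) (noOpp : NoOpposite B) where

      -- With its first coefficient zero, `cramer` becomes a nonnegative relation between `q` and
      -- `r` alone.
      flat : ∀ {p q r} → Triangle B p q r → ω q r ≡ + 0 → ⊥
      flat {p} {q} {r} (triangle bp bq br qr rp pq proper) qr≡0 =
        ¬opposite-rays B≥0 noOpp bq br (ω r p) (ω p q) rp pq
          (proper by trans (cong (λ a → a + ω r p + ω p q - + 1) qr≡0) (unit (ω r p) (ω p q)))
          λ k → trans (pad (ω r p * q k) (ω p q * r k) (p k))
            (trans (cong (λ a → a * p k + ω r p * q k + ω p q * r k) (sym qr≡0))
                   (cramer (proj₁ bp) (proj₁ bq) (proj₁ br) k))
        where
        unit : ∀ a b → + 0 + a + b - + 1 ≡ a + b - + 1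
        unit = solve-∀
        pad : ∀ a b c → a + b ≡ + 0 * c + a + b
        pad = solve-∀

      nonflat : ∀ {p q r} → Triangle B p q r → + 0 ≤ ω q r - + 1
      nonflat T = ≢0⇒≥1 _ (Triangle.qr T) (flat T)

      -- By minimality each pair of vertices spans the lattice, so the positive determinants divide
      -- one another and are equal; `cramer` then says that `ω p q` times `p + q + r` is zero.
      minimal⇒unimodular : ∀ {p q r} → Triangle B p q r → ¬ Smaller B (perimeter p q r) → Unimodular B p q r
      minimal⇒unimodular {p} {q} {r} T minimal = record
        { p∈ = p∈ ; q∈ = q∈ ; r∈ = r∈ ; oriented = hD ; basis = basis
        ; centred = λ k → *-cancel-≡0 {ω p q} (≥1⇒≢0 hD)
            (trans (distribute (ω p q) (p k) (q k) (r k))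
              (trans (cong₂ (λ a b → a * p k + b * q k + ω p q * r k) (sym α≡D) (sym β≡D))
                     (cramer (proj₁ p∈) (proj₁ q∈) (proj₁ r∈) k)))
        }
        where
        open Triangle T
        hα = nonflat T
        hβ = nonflat (rotate T)
        hD = nonflat (rotate (rotate T))
        spanned : ∀ {p q r z} → Triangle B p q r → ¬ Smaller B (perimeter p q r) →
          + 0 ≤ ω q r - + 1 → + 0 ≤ ω r p - + 1 → + 0 ≤ ω p q - + 1 → L z → SpannedBy p q z
        spanned T min hα hβ hD Lz =
          either (spanned-or-smaller B≥0 T hα hβ hD Lz) id (λ smaller → ⊥-elim (min smaller))
        basis : ∀ {z} → L z → SpannedBy p q z
        basis = spanned T minimal hα hβ hD
        cycle : ∀ a b c → a + b + c ≡ b + c + a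
        cycle = solve-∀
        minimal′ : ¬ Smaller B (perimeter q r p)
        minimal′ m = minimal (subst (Smaller B) (sym (cycle (ω q r) (ω r p) (ω p q))) m)
        minimal″ : ¬ Smaller B (perimeter r p q)
        minimal″ m = minimal (subst (Smaller B) (cycle (ω p q) (ω q r) (ω r p)) m)
        α≡D : ω q r ≡ ω p q
        α≡D = ℤ.≤-antisym
          (ℤ.0≤i-j⇒j≤i (multiple-≥ (ω p q) (ω q r) hD hα
            (spanned-detʳ (spanned (rotate T) minimal′ hβ hD hα (proj₁ p∈)))))
          (ℤ.0≤i-j⇒j≤i (multiple-≥ (ω q r) (ω p q) hα hD (spanned-detˡ (basis (proj₁ r∈)))))
        β≡D : ω r p ≡ ω p q
        β≡D = ℤ.≤-antisym
          (ℤ.0≤i-j⇒j≤i (multiple-≥ (ω p q) (ω r p) hD hβ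
            (spanned-detˡ (spanned (rotate (rotate T)) minimal″ hD hα hβ (proj₁ q∈)))))
          (ℤ.0≤i-j⇒j≤i (multiple-≥ (ω r p) (ω p q) hβ hD (spanned-detʳ (basis (proj₁ r∈)))))
        distribute : ∀ D a b c → D * (a + b + c) ≡ D * a + D * b + D * c
        distribute = solve-∀

      -- Descent on the area. As the goal is ⊥, the refutation of smaller triangles that
      -- `minimal⇒unimodular` asks for is the induction hypothesis itself.
      ¬triangle : (∀ {p q r} → Unimodular B p q r → ⊥) → ∀ {p q r} → Triangle B p q r → ⊥
      ¬triangle noUni {p} {q} {r} T = descend ∣ N₀ ∣ T
          (0≤0 by trans (sym (ℤ.+-inverseʳ N₀)) (cong (_- N₀) (sym (ℤ.0≤i⇒+∣i∣≡i (≥1⇒≥0 N₀ (Triangle.proper T))))))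
        where
        N₀ = perimeter p q r
        step : ∀ N P Q → + 0 ≤ + 1 + N - P → + 0 ≤ P - Q - + 1 → + 0 ≤ N - Q
        step N P Q h g = h ⊕ g by solve (N ∷ P ∷ Q ∷ [])
        collapse : ∀ P → + 0 - P + (P - + 1) ≡ - + 1
        collapse = solve-∀
        descend : ∀ N {p q r} → Triangle B p q r → + 0 ≤ + N - perimeter p q r → ⊥
        descend ℕ.zero {p} {q} {r} T h = absurd (h ⊕ Triangle.proper T) (collapse (perimeter p q r))
        descend (ℕ.suc N) {p} {q} {r} T h = noUni (minimal⇒unimodular T
          λ (p′ , q′ , r′ , T′ , g) →
            descend N T′ (step (+ N) (perimeter p q r) (perimeter p′ q′ r′) h g))

    blocked : ∀ {B p} → NoOpposite B → Body B p → ∃ λ k → C k × + 0 ≤ - p k - B k - + 1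
    blocked {B} {p} noOpp bp@(Lp , p≢0 , _) =
      decide (Fin.any? (λ k → C? k ×-dec (+ 0 ℤ.≤? - p k - B k - + 1))) id
        (λ none → ⊥-elim (noOpp bp (L-neg Lp , Nonzero-neg p≢0 , λ k Ck →
          either (≤-or-> (- p k) (B k)) id (λ h → ⊥-elim (none (k , Ck , h))))))

    module _ {B p q r} (U : Unimodular B p q r) where
      open Unimodular U

      centred-ω : ω q r ≡ ω p q
      centred-ω = ℤ.i-j≡0⇒i≡j (ω q r) (ω p q) (trans (eq (p s) (p t) (q s) (q t) (r s) (r t))
        (trans (cong₂ (λ a b → q s * a - q t * b) (centred t) (centred s)) (collapse (q s) (q t))))
        where
        eq : ∀ p₁ p₂ q₁ q₂ r₁ r₂ → (q₁ * r₂ - q₂ * r₁) - (p₁ * q₂ - p₂ * q₁) ≡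
          q₁ * (p₂ + q₂ + r₂) - q₂ * (p₁ + q₁ + r₁)
        eq = solve-∀
        collapse : ∀ a b → a * + 0 - b * + 0 ≡ + 0
        collapse = solve-∀

      rotateU : Unimodular B q r p
      rotateU = record
        { p∈ = q∈ ; q∈ = r∈ ; r∈ = p∈
        ; centred = λ k → trans (cycle (p k) (q k) (r k)) (centred k)
        ; oriented = oriented by cong (_- + 1) (sym centred-ω)
        ; basis = λ Lz → respan (basis Lz)
        }
        where
        cycle : ∀ p q r → q + r + p ≡ p + q + r
        cycle = solve-∀
        change : ∀ x y p q r → x * p + y * q ≡ (y - x) * q + (- x) * r + x * (p + q + r)
        change = solve-∀
        respan : ∀ {z} → SpannedBy p q z → SpannedBy q r z
        respan (x , y , e) = y - x , - x , λ k →
          trans (e k) (trans (change x y (p k) (q k) (r k))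
            (trans (cong (λ a → (y - x) * q k + (- x) * r k + x * a) (centred k))
              (trans (cong (λ a → (y - x) * q k + (- x) * r k + a) (ℤ.*-zeroʳ x))
                (ℤ.+-identityʳ _))))

    third≥1 : ∀ p q r B → p + q + r ≡ + 0 → + 0 ≤ - p - B - + 1 → + 0 ≤ B - q → + 0 ≤ r - + 1
    third≥1 p q r B e hp hq = hp ⊕ hq ⊕ ≡⇒0≤ (sym e) by solve (p ∷ q ∷ r ∷ B ∷ [])

    -- `- p - q` is at least 1, so `y ≥ x + 1` would make `x * p + y * q` at least
    -- `(- x) * (- p - q) + q`, hence at least `- p`, which exceeds `B`.
    half-cone : ∀ p q B x y → + 0 ≤ - p - B - + 1 → + 0 ≤ q - + 1 → + 0 ≤ B - q →
      + 0 ≤ B - (x * p + y * q) → + 0 ≤ - x - + 1 → + 0 ≤ x - y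
    half-cone p q B x y hp hq hBq hz hx = either {C = + 0 ≤ x - y} (≤-or-> y x) id
      λ h → ⊥-elim (absurd (hz ⊕ hq ⊗ h ⊕ h ⊕ hx ⊗ (hp ⊕ hBq) ⊕ hp ⊕ hx) (solve (p ∷ q ∷ B ∷ x ∷ y ∷ [])))

    -- Coefficients of a point of cone(p,q), or of a nonzero point on the ray of `r`, which is
    -- `- p - q`.
    ConeOrDiagonal : ℤ → ℤ → Set
    ConeOrDiagonal x y = (+ 0 ≤ x × + 0 ≤ y) ⊎ (x ≡ y × + 0 ≤ - x - + 1)

    cone-or-diagonal : ∀ x y → (+ 0 ≤ - x - + 1 → + 0 ≤ x - y) → (+ 0 ≤ - y - + 1 → + 0 ≤ y - x) →
      ConeOrDiagonal x y
    cone-or-diagonal x y f g = either (sign x)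
      (λ hx → either (sign y) (λ hy → inj₁ (hx , hy))
        (λ hy → ⊥-elim (absurd (hx ⊕ g hy ⊕ hy) (solve (x ∷ y ∷ [])))))
      (λ hx → inj₂ (ℤ.≤-antisym (ℤ.0≤i-j⇒j≤i (g (f hx ⊕ hx by shift x y))) (ℤ.0≤i-j⇒j≤i (f hx)) , hx))
      where
      shift : ∀ x y → x - y + (- x - + 1) ≡ - y - + 1
      shift = solve-∀

    -- The constraint k violated by − p and the constraint l violated by − q hold at r = − p − q.
    -- They are so steep that no lattice points outside cone(p,q) and the ray of r satisfy both.
    module _ {B p q r} (U : Unimodular B p q r) (k l : Fin n) (Ck : C k) (Cl : C l)
             (hk : + 0 ≤ - p k - B k - + 1) (hl : + 0 ≤ - q l - B l - + 1) where
      open Unimodular U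

      q-at-k : + 0 ≤ q k - + 1
      q-at-k = third≥1 (p k) (r k) (q k) (B k) (trans (swap (p k) (q k) (r k)) (centred k)) hk (proj₂ (proj₂ r∈) k Ck)
        where
        swap : ∀ p q r → p + r + q ≡ p + q + r
        swap = solve-∀

      p-at-l : + 0 ≤ p l - + 1
      p-at-l = third≥1 (q l) (r l) (p l) (B l) (trans (swap (p l) (q l) (r l)) (centred l)) hl (proj₂ (proj₂ r∈) l Cl)
        where
        swap : ∀ p q r → q + r + p ≡ p + q + r
        swap = solve-∀

      r-at-k : + 0 ≤ r k - + 1
      r-at-k = third≥1 (p k) (q k) (r k) (B k) (centred k) hk (proj₂ (proj₂ q∈) k Ck)

      k≢l : NonNegative B → k ≢ l
      k≢l B≥0 refl = absurd (p-at-l ⊕ hk ⊕ B≥0 k Ck ⊕ 0≤1) (contra (p k) (B k))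
        where
        contra : ∀ p B → p - + 1 + (- p - B - + 1) + B + + 1 ≡ - + 1
        contra = solve-∀

      locate : ∀ {z : Vecℤ n} {x y : ℤ} → (∀ j → z j ≡ x * p j + y * q j) → + 0 ≤ B k - z k → + 0 ≤ B l - z l → ConeOrDiagonal x y
      locate {z} {x} {y} e zk zl = cone-or-diagonal x y
        (half-cone (p k) (q k) (B k) x y hk q-at-k (proj₂ (proj₂ q∈) k Ck) (zk by cong (λ a → B k - a) (e k)))
        (half-cone (q l) (p l) (B l) y x hl p-at-l (proj₂ (proj₂ p∈) l Cl)
          (zl by cong (λ a → B l - a) (trans (e l) (ℤ.+-comm (x * p l) (y * q l)))))

    -- Relaxed polygons

    module Polygon (w : Exp n) where

      W : Vecℤ n
      W k = + w k

      -- The exponent of `x_i x^w`; as a bound it relaxes the constraint `i` by 1.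
      bump : Fin n → Vecℤ n
      bump i k = + (δ i k ℕ.+ w k)

      W≥0 : NonNegative W
      W≥0 k _ = +≤+ z≤n

      bump≥0 : ∀ i → NonNegative (bump i)
      bump≥0 i k _ = +≤+ z≤n

      bump-other : ∀ {i k} → i ≢ k → bump i k ≡ W k
      bump-other {k = k} i≢k = cong (λ d → + (d ℕ.+ w k)) (δ-other i≢k)

      W⇒bump : ∀ i k a → + 0 ≤ W k - a → + 0 ≤ bump i k - a
      W⇒bump i k a h = h ⊕ +≤+ {0} {δ i k} z≤n by move (W k) a (+ δ i k)
        where
        move : ∀ W a d → W - a + d ≡ d + W - a
        move = solve-∀

      off-bump : ∀ {l k z} → Body (bump l) z → C k → l ≢ k → + 0 ≤ W k - z k
      off-bump {k = k} {z} (_ , _ , hz) Ck l≢k = hz k Ck by cong (_- z k) (bump-other l≢k)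

      unbump : ∀ {i z} → Body (bump i) z → + 0 ≤ W i - z i → Body W z
      unbump {i} {z} bz@(Lz , z≢0 , _) hi = Lz , z≢0 , λ k Ck →
        decide (i ≟ k) (λ i≡k → subst (λ k → + 0 ≤ W k - z k) i≡k hi) (off-bump bz Ck)

      -- `h` lies in the polygon, and `- h` leaves it through the constraint `i` alone.
      record Spike (i : Fin n) (h : Vecℤ n) : Set where
        field
          h∈ : Body W h
          tip : + 0 ≤ - h i - W i - + 1
          elsewhere : ∀ k → C k → i ≢ k → + 0 ≤ W k + h k

      module _
        -- The vertex property is phrased for three points; a pair is entered with one point
        -- repeated at weight zero.
        (pointed : ∀ {p q r} x y z → Body W p → Body W q → Body W r → + 0 ≤ x → + 0 ≤ y → + 0 ≤ z →
          + 0 ≤ x + y + z - + 1 → (∀ k → x * p k + y * q k + z * r k ≡ + 0) → ⊥)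
        (relation : ∀ l → C l → Relation (Body (bump l))) where

        Goal : Set
        Goal = ∃ λ g → L g × (∀ k → C k → + 0 ≤ - g k - + 1)

        -- The origin is not a midpoint in the unrelaxed polygon, so one of `p`, `- p` exceeds
        -- `w i`; the other one is the spike.
        opposite⇒spike : ∀ {i p} → C i → Body (bump i) p → Body (bump i) (neg p) → ∃ (Spike i)
        opposite⇒spike {i} {p} Ci bp bn = either (≤-or-> (p i) (W i))
          (λ h → either (≤-or-> (- p i) (W i))
            (λ h′ → ⊥-elim (pointed {p} {neg p} {p} (+ 1) (+ 1) (+ 0) (unbump bp h) (unbump bn h′) (unbump bp h)
              0≤1 0≤1 0≤0 0≤1 (λ k → vanish (p k))))
            (λ h′ → p , record { h∈ = unbump bp h ; tip = h′
              ; elsewhere = λ k Ck i≢k → off-bump bn Ck i≢k by cong (λ a → W k + a) (ℤ.neg-involutive (p k)) }))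
          (λ h → neg p , record { h∈ = unbump bn (below (p i) (W i) h (W≥0 i Ci))
            ; tip = h by cong (λ a → a - W i - + 1) (sym (ℤ.neg-involutive (p i)))
            ; elsewhere = λ k Ck i≢k → off-bump bp Ck i≢k })
          where
          vanish : ∀ p → + 1 * p + + 1 * - p + + 0 * p ≡ + 0
          vanish = solve-∀
          below : ∀ p W → + 0 ≤ p - W - + 1 → + 0 ≤ W → + 0 ≤ W - - p
          below p W h hW = h ⊕ hW ⊕ hW ⊕ 0≤1 by solve (p ∷ W ∷ [])

        span-nonzero : ∀ {p q z : Vecℤ n} {x y : ℤ} → Nonzero z → (∀ k → z k ≡ x * p k + y * q k) →
          + 0 ≤ x → + 0 ≤ y → + 0 ≤ x + y - + 1
        span-nonzero {p} {q} {z} {x} {y} (k , zk≢0) e hx hy = either (sign (x + y - + 1)) id λ h →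
          ⊥-elim (zk≢0 (trans (e k) (cong₂ (λ a b → a * p k + b * q k)
            (antisym₀ x hx (h ⊕ hy by left x y)) (antisym₀ y hy (h ⊕ hx by right x y)))))
          where
          left : ∀ x y → - (x + y - + 1) - + 1 + y ≡ - x
          left = solve-∀
          right : ∀ x y → - (x + y - + 1) - + 1 + x ≡ - y
          right = solve-∀

        module _ {i p q r} (Ci : C i) (U : Unimodular (bump i) p q r) (k l : Fin n) (Ck : C k) (Cl : C l)
                 (hk : + 0 ≤ - p k - bump i k - + 1) (hl : + 0 ≤ - q l - bump i l - + 1) where
          open Unimodular U

          diagonal : ∀ {z : Vecℤ n} {x y : ℤ} → (∀ j → z j ≡ x * p j + y * q j) → x ≡ y → ∀ j → z j ≡ (- x) * r j
          diagonal {z} {x} e refl j =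
            trans (e j) (trans (shape x (p j) (q j) (r j))
              (trans (cong (λ a → x * a + (- x) * r j) (centred j))
                (trans (cong (_+ (- x) * r j) (ℤ.*-zeroʳ x)) (ℤ.+-identityˡ ((- x) * r j)))))
            where
            shape : ∀ x p q r → x * p + x * q ≡ x * (p + q + r) + (- x) * r
            shape = solve-∀

          -- `p + q` is negative at `i` because `r i` is positive, and at `k` and `l` because there
          -- the negative of one vector exceeds a bound that the other obeys. `C` has no further
          -- index `m`: with `m` relaxed, the constraints `i`, `k`, `l` still confine the lattice
          -- points to cone(p,q), and the origin would stay a vertex.
          one-new-vertex : + 0 ≤ W i - p i → + 0 ≤ W i - q i → + 0 ≤ r i - W i - + 1 → Goal
          one-new-vertex hp hq hr =
            (λ j → + 1 * p j + + 1 * q j) , L-comb (+ 1) (+ 1) (proj₁ p∈) (proj₁ q∈) , negative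
            where
            sum : ∀ j → + 0 ≤ - p j - bump i j - + 1 → + 0 ≤ bump i j - q j →
              + 0 ≤ - (+ 1 * p j + + 1 * q j) - + 1
            sum j h h′ = h ⊕ h′ by eq (p j) (q j) (bump i j)
              where
              eq : ∀ p q B → - p - B - + 1 + (B - q) ≡ - (+ 1 * p + + 1 * q) - + 1
              eq = solve-∀
            at-i : + 0 ≤ - (+ 1 * p i + + 1 * q i) - + 1
            at-i = hr ⊕ W≥0 i Ci ⊕ ≡⇒0≤ (centred i) by eq (p i) (q i) (r i) (W i)
              where
              eq : ∀ p q r W → r - W - + 1 + W + (+ 0 - (p + q + r)) ≡ - (+ 1 * p + + 1 * q) - + 1
              eq = solve-∀
            functional : ∀ p₁ p₂ q₁ q₂ z₁ z₂ → (p₁ * z₂ - p₂ * z₁) + (z₁ * q₂ - z₂ * q₁) ≡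
              (q₂ - p₂) * z₁ + (p₁ - q₁) * z₂
            functional = solve-∀
            height : ∀ x y p₁ p₂ q₁ q₂ →
              (p₁ * (x * p₂ + y * q₂) - p₂ * (x * p₁ + y * q₁)) + ((x * p₁ + y * q₁) * q₂ - (x * p₂ + y * q₂) * q₁)
              ≡ (x + y) * (p₁ * q₂ - p₂ * q₁)
            height = solve-∀
            too-far : ∀ x r W → + 0 ≤ - x - + 1 → + 0 ≤ r - W - + 1 → + 0 ≤ W → + 0 ≤ W - (- x) * r → ⊥
            too-far x r W hx hr hW h = absurd (h ⊕ hx ⊗ hr ⊕ hr ⊕ hx ⊗ hW ⊕ hx) (solve (x ∷ r ∷ W ∷ []))
            positive : ∀ {m} → i ≢ m → k ≢ m → l ≢ m → ∀ {z} → Body (bump m) z → + 0 ≤ ω p z + ω z q - + 1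
            positive i≢m k≢m l≢m {z} bz = split (basis (proj₁ bz))
              where
              below-i : + 0 ≤ W i - z i
              below-i = off-bump bz Ci (λ e → i≢m (sym e))
              split : SpannedBy p q z → + 0 ≤ ω p z + ω z q - + 1
              split (x , y , e) = either
                (locate U k l Ck Cl hk hl {z} {x} {y} e
                  (W⇒bump i k (z k) (off-bump bz Ck (λ e → k≢m (sym e))))
                  (W⇒bump i l (z l) (off-bump bz Cl (λ e → l≢m (sym e)))))
                (λ (hx , hy) → *-≥1 (x + y) (ω p q) (span-nonzero {p} {q} {z} {x} {y} (proj₁ (proj₂ bz)) e hx hy) oriented
                  by cong (_- + 1) (sym (trans
                    (cong₂ (λ a b → (p s * b - p t * a) + (a * q t - b * q s)) (e s) (e t))
                    (height x y (p s) (p t) (q s) (q t)))))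
                (λ (x≡y , hx) → ⊥-elim (too-far x (r i) (W i) hx hr (W≥0 i Ci)
                  (below-i by cong (λ a → W i - a) (diagonal {z} {x} {y} e x≡y i))))
            negative : ∀ m → C m → + 0 ≤ - (+ 1 * p m + + 1 * q m) - + 1
            negative m Cm = decide (i ≟ m) (λ { refl → at-i }) λ i≢m →
              decide (k ≟ m) (λ k≡m → subst (λ m → + 0 ≤ - (+ 1 * p m + + 1 * q m) - + 1) k≡m
                (sum k hk (proj₂ (proj₂ q∈) k Ck))) λ k≢m →
              decide (l ≟ m) (λ l≡m → subst (λ m → + 0 ≤ - (+ 1 * p m + + 1 * q m) - + 1) l≡m
                (flip l hl (proj₂ (proj₂ p∈) l Cl))) λ l≢m →
              -- These coefficients give the functional `ω p z + ω z q`, which is `(x + y) * ω p q`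
              -- at `x p + y q`.
              ⊥-elim (Relation.¬positive-functional (relation m Cm) (q t - p t) (p s - q s) s t λ j _ →
                positive i≢m k≢m l≢m (Relation.pt∈ (relation m Cm) j)
                  by cong (_- + 1) (functional (p s) (p t) (q s) (q t) _ _))
              where
              flip : ∀ j → + 0 ≤ - q j - bump i j - + 1 → + 0 ≤ bump i j - p j →
                + 0 ≤ - (+ 1 * p j + + 1 * q j) - + 1
              flip j h h′ = h ⊕ h′ by eq (p j) (q j) (bump i j)
                where
                eq : ∀ p q B → - q - B - + 1 + (B - p) ≡ - (+ 1 * p + + 1 * q) - + 1
                eq = solve-∀

          -- With `k` relaxed, every lattice point `z` still has `z k` positive, against the
          -- relation for `k`. Otherwise `locate` applies to `z`; but in cone(p,q) the constraint
          -- `i` fails, and on the ray of `r` the coordinate `k` is positive.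
          two-new-vertices : + 0 ≤ p i - W i - + 1 → + 0 ≤ q i - W i - + 1 → ⊥
          two-new-vertices hp hq =
            Relation.¬positive-functional (relation k Ck) (+ 1) (+ 0) k k λ j _ →
              positive (Relation.pt∈ (relation k Ck) j) by cong (_- + 1) (sym (unit (Relation.pt (relation k Ck) j k)))
            where
            unit : ∀ a → + 1 * a + + 0 * a ≡ a
            unit = solve-∀
            too-steep : ∀ p B W → + 0 ≤ - p - B - + 1 → + 0 ≤ B → + 0 ≤ p - W - + 1 → + 0 ≤ W → ⊥
            too-steep p B W h hB hp hW = absurd (h ⊕ hB ⊕ hp ⊕ hW ⊕ 0≤1) (solve (p ∷ B ∷ W ∷ []))
            k≢i : k ≢ i
            k≢i k≡i = too-steep (p i) (bump i i) (W i) (subst (λ m → + 0 ≤ - p m - bump i m - + 1) k≡i hk)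
              (bump≥0 i i Ci) hp (W≥0 i Ci)
            too-high : ∀ x y p q W → + 0 ≤ x → + 0 ≤ y → + 0 ≤ x + y - + 1 → + 0 ≤ p - W - + 1 →
              + 0 ≤ q - W - + 1 → + 0 ≤ W → + 0 ≤ W - (x * p + y * q) → ⊥
            too-high x y p q W hx hy hxy hp hq hW h =
              absurd (hx ⊗ hp ⊕ hy ⊗ hq ⊕ hxy ⊗ hW ⊕ hxy ⊕ h) (solve (x ∷ y ∷ p ∷ q ∷ W ∷ []))
            reach : ∀ z B → + 0 ≤ - (z - + 1) - + 1 → + 0 ≤ B → + 0 ≤ B - z
            reach z B h hB = h ⊕ hB by solve (z ∷ B ∷ [])
            positive : ∀ {z} → Body (bump k) z → + 0 ≤ z k - + 1
            positive {z} bz = either {C = + 0 ≤ z k - + 1} (sign (z k - + 1)) id λ low → ⊥-elim (split low (basis (proj₁ bz)))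
              where
              split : + 0 ≤ - (z k - + 1) - + 1 → SpannedBy p q z → ⊥
              split low (x , y , e) = either
                (locate U k l Ck Cl hk hl {z} {x} {y} e
                  (reach (z k) (bump i k) low (bump≥0 i k Ck))
                  (W⇒bump i l (z l) (off-bump bz Cl (k≢l U k l Ck Cl hk hl (bump≥0 i)))))
                (λ (hx , hy) → too-high x y (p i) (q i) (W i) hx hy
                  (span-nonzero {p} {q} {z} {x} {y} (proj₁ (proj₂ bz)) e hx hy) hp hq (W≥0 i Ci)
                  (off-bump bz Ci k≢i by cong (λ a → W i - a) (e i)))
                (λ (x≡y , hx) → product<1 (- x) (r k) hx (r-at-k U k l Ck Cl hk hl)
                  (low by cong (λ a → - (a - + 1) - + 1) (diagonal {z} {x} {y} e x≡y k)))
                where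
                product<1 : ∀ x r → + 0 ≤ x - + 1 → + 0 ≤ r - + 1 → + 0 ≤ - (x * r - + 1) - + 1 → ⊥
                product<1 x r hx hr h = absurd (*-≥1 x r hx hr ⊕ h) (solve (x ∷ r ∷ []))

        -- The cases count the vertices that violate the unrelaxed constraint `i`; none at all
        -- contradicts `pointed`.
        unimodular⇒goal : ∀ {i p q r} → C i → NoOpposite (bump i) → Unimodular (bump i) p q r → Goal
        unimodular⇒goal {i} {p} {q} {r} Ci noOpp U =
          either (≤-or-> (p i) (W i))
            (λ hp → either (≤-or-> (q i) (W i))
              (λ hq → either (≤-or-> (r i) (W i))
                (λ hr → ⊥-elim (pointed {p} {q} {r} (+ 1) (+ 1) (+ 1) (unbump p∈ hp) (unbump q∈ hq) (unbump r∈ hr)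
                  0≤1 0≤1 0≤1 (+≤+ z≤n) λ k → trans (unit (p k) (q k) (r k)) (centred k)))
                (one U hp hq))
              (λ hq → either (≤-or-> (r i) (W i))
                (λ hr → one (rotateU (rotateU U)) hr hp hq)
                (λ hr → ⊥-elim (two (rotateU U) hq hr))))
            (λ hp → either (≤-or-> (q i) (W i))
              (λ hq → either (≤-or-> (r i) (W i))
                (λ hr → one (rotateU U) hq hr hp)
                (λ hr → ⊥-elim (two (rotateU (rotateU U)) hr hp)))
              (λ hq → ⊥-elim (two U hp hq)))
          where
          open Unimodular U
          unit : ∀ p q r → + 1 * p + + 1 * q + + 1 * r ≡ p + q + r
          unit = solve-∀
          one : ∀ {p q r} → Unimodular (bump i) p q r →
            + 0 ≤ W i - p i → + 0 ≤ W i - q i → + 0 ≤ r i - W i - + 1 → Goal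
          one U with blocked noOpp (Unimodular.p∈ U) | blocked noOpp (Unimodular.q∈ U)
          ... | k , Ck , hk | l , Cl , hl = one-new-vertex Ci U k l Ck Cl hk hl
          two : ∀ {p q r} → Unimodular (bump i) p q r → + 0 ≤ p i - W i - + 1 → + 0 ≤ q i - W i - + 1 → ⊥
          two U with blocked noOpp (Unimodular.p∈ U) | blocked noOpp (Unimodular.q∈ U)
          ... | k , Ck , hk | l , Cl , hl = two-new-vertices Ci U k l Ck Cl hk hl

        -- Without a spike at `i` there is no opposite pair, and without `Goal` no unimodular
        -- triangle, so the origin would remain a vertex after relaxing `i`.
        ¬¬spike : ¬ Goal → ∀ i → C i → ¬ ¬ ∃ (Spike i)
        ¬¬spike ¬goal i Ci ¬spike =
          ¬relation (bump≥0 i) noOpp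
            (¬triangle (bump≥0 i) noOpp λ U → ¬goal (unimodular⇒goal Ci noOpp U)) (relation i Ci)
          where
          noOpp : NoOpposite (bump i)
          noOpp bp bn = ¬spike (opposite⇒spike Ci bp bn)

        -- The two extreme spikes

        W-noOpposite : NoOpposite W
        W-noOpposite {p} bp bn = pointed {p} {neg p} {p} (+ 1) (+ 1) (+ 0) bp bn bp 0≤1 0≤1 0≤0 0≤1 (λ k → vanish (p k))
          where
          vanish : ∀ p → + 1 * p + + 1 * - p + + 0 * p ≡ + 0
          vanish = solve-∀

        W-noTriangle : ∀ {p q r} → Triangle W p q r → ⊥
        W-noTriangle {p} {q} {r} (triangle bp bq br qr rp pq proper) =
          pointed {p} {q} {r} (ω q r) (ω r p) (ω p q) bp bq br qr rp pq proper (cramer (proj₁ bp) (proj₁ bq) (proj₁ br))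

        -- The bounds `x ≥ - W`, `y ≤ - W - 1`, `z ≤ W` turn the relation into
        -- `α * (W + 1) ≤ (β + γ) * W`.
        dominated : ∀ W α β γ x y z → + 0 ≤ W → + 0 ≤ α → + 0 ≤ β → + 0 ≤ γ → γ * x ≡ α * y + β * z →
          + 0 ≤ W + x → + 0 ≤ - y - W - + 1 → + 0 ≤ W - z → + 0 ≤ β + γ - α
        dominated W α β γ x y z hW hα hβ hγ e hx hy hz = either {C = + 0 ≤ β + γ - α} (sign (β + γ - α)) id
          λ h → ⊥-elim (absurd
            (hγ ⊗ hx ⊕ hα ⊗ hy ⊕ hβ ⊗ hz ⊕ ≡⇒0≤ e ⊕ hW ⊗ h ⊕ hW ⊕ h ⊕ hβ ⊕ hγ)
            (solve (W ∷ α ∷ β ∷ γ ∷ x ∷ y ∷ z ∷ [])))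

        -- `α * y + β * z` is `α * (y + z) + (β - α) * z`, hence at least `- (γ * W)`, whereas
        -- `γ * x` is at most `- (γ * (W + 1))`.
        sum-negative′ : ∀ W α β γ x y z → + 0 ≤ W → + 0 ≤ α → + 0 ≤ β - α → + 0 ≤ γ - + 1 → γ * x ≡ α * y + β * z →
          + 0 ≤ - x - W - + 1 → + 0 ≤ W + z → + 0 ≤ α + γ - β → + 0 ≤ y + z → ⊥
        sum-negative′ W α β γ x y z hW hα hβα hγ e hx hz hβ h = absurd
          (hα ⊗ h ⊕ hβα ⊗ hz ⊕ hβ ⊗ hW ⊕ ≡⇒0≤ (sym e) ⊕ hγ ⊗ hx ⊕ hx ⊕ hγ)
          (solve (W ∷ α ∷ β ∷ γ ∷ x ∷ y ∷ z ∷ []))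

        sum-negative : ∀ W α β γ x y z → + 0 ≤ W → + 0 ≤ α → + 0 ≤ β → + 0 ≤ γ - + 1 → γ * x ≡ α * y + β * z →
          + 0 ≤ - x - W - + 1 → + 0 ≤ W + y → + 0 ≤ W + z → + 0 ≤ β + γ - α → + 0 ≤ α + γ - β →
          + 0 ≤ - (+ 1 * y + + 1 * z) - + 1
        sum-negative W α β γ x y z hW hα hβ hγ e hx hy hz hβγ hαγ =
          either {C = + 0 ≤ - (+ 1 * y + + 1 * z) - + 1} (sign (- (+ 1 * y + + 1 * z) - + 1)) id λ h → ⊥-elim
            (either (≤-or-> α β)
              (λ α≤β → sum-negative′ W α β γ x y z hW hα α≤β hγ e hx hz hαγ (h by eq y z))
              (λ β<α → sum-negative′ W β α γ x z y hW hβ (≥1⇒≥0 (α - β) β<α) hγ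
                (trans e (ℤ.+-comm (α * y) (β * z))) hx hy hβγ (h by eq′ y z)))
          where
          eq : ∀ y z → - (- (+ 1 * y + + 1 * z) - + 1) - + 1 ≡ y + z
          eq = solve-∀
          eq′ : ∀ y z → - (- (+ 1 * y + + 1 * z) - + 1) - + 1 ≡ z + y
          eq′ = solve-∀

        negative-multiple : ∀ W x y p q → + 0 ≤ W → + 0 ≤ x - + 1 → + 0 ≤ y → y * p ≡ x * q →
          + 0 ≤ - q - W - + 1 → + 0 ≤ - p - + 1
        negative-multiple W x y p q hW hx hy e hq = either {C = + 0 ≤ - p - + 1} (sign (- p - + 1)) id λ h → ⊥-elim
          (absurd (hx ⊗ hq ⊕ hq ⊕ hx ⊗ hW ⊕ hW ⊕ hx ⊕ hy ⊗ h ⊕ ≡⇒0≤ e) (solve (W ∷ x ∷ y ∷ p ∷ q ∷ [])))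

        -- All spikes lie between the first, `h a`, and the last, `h b`, with `γ * h l` equal to
        -- `α * h a + β * h b`. The constraints `a` and `b` bound `α` and `β` through `dominated`,
        -- and the tip of `h l` then makes `h a + h b` negative at `l`. If `γ` is zero, all spikes
        -- share a ray and `h a` suffices.
        spikes⇒goal : ∃ C → (h : Fin n → Vecℤ n) → (∀ i → C i → Spike i (h i)) → Goal
        spikes⇒goal someC h spike =
          conclude
            (least C? (λ i j → + 0 ≤ ω (h i) (h j))
              (λ i j _ _ → turn-total W≥0 W-noOpposite W-noTriangle (h i) (h j))
              (λ i j k Ci Cj Ck → turn-trans W≥0 W-noOpposite W-noTriangle (at Ci) (at Cj) (at Ck)) someC)
            (least C? (λ i j → + 0 ≤ ω (h j) (h i))
              (λ i j _ _ → turn-total W≥0 W-noOpposite W-noTriangle (h j) (h i))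
              (λ i j k Ci Cj Ck ij jk → turn-trans W≥0 W-noOpposite W-noTriangle (at Ck) (at Cj) (at Ci) jk ij) someC)
          where
          at : ∀ {i} → C i → Body W (h i)
          at {i} Ci = Spike.h∈ (spike i Ci)
          bound : ∀ {i} → C i → ∀ k → C k → + 0 ≤ W k - h i k
          bound Ci = proj₂ (proj₂ (at Ci))
          conclude : (∃ λ a → C a × (∀ j → C j → + 0 ≤ ω (h a) (h j))) →
                     (∃ λ b → C b × (∀ j → C j → + 0 ≤ ω (h j) (h b))) → Goal
          conclude (a , Ca , first) (b , Cb , last) = decide (γ ℤ.≟ + 0) flat-goal wide-goal
            where
            γ = ω (h a) (h b)
            flat-goal : γ ≡ + 0 → Goal
            flat-goal γ≡0 = h a , proj₁ (at Ca) , negative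
              where
              collinear : ∀ {l} → C l → ω (h a) (h l) ≡ + 0
              collinear {l} Cl = decide (ω (h a) (h l) ℤ.≟ + 0) id λ β≢0 → ⊥-elim
                (W-noTriangle (triangle (at Ca) (at Cl) (at Cb) (last l Cl)
                  (0≤0 by sym ba≡0) (first l Cl)
                  (last l Cl ⊕ ≢0⇒≥1 _ (first l Cl) β≢0 by
                    trans (pad (ω (h l) (h b)) (ω (h a) (h l)))
                      (cong (λ c → ω (h l) (h b) + c + ω (h a) (h l) - + 1) (sym ba≡0)))))
                where
                ba≡0 : ω (h b) (h a) ≡ + 0
                ba≡0 = trans (ω-flip (h a) (h b)) (cong -_ γ≡0)
                pad : ∀ a b → a + (b - + 1) ≡ a + + 0 + b - + 1
                pad = solve-∀
              negative : ∀ l → C l → + 0 ≤ - h a l - + 1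
              negative l Cl with nondegenerate (proj₁ (at Ca)) (proj₁ (proj₂ (at Ca)))
              ... | x , Lx , X≢0 =
                negative-multiple (W l) (X * X) (X * Y) (h a l) (h l l) (W≥0 l Cl) (square≥1 X X≢0)
                  (≥1⇒≥0 (X * Y) (same-side W≥0 W-noOpposite (at Ca) (at Cl) Lx X≢0 (collinear Cl)))
                  (trans (ℤ.*-assoc X Y (h a l))
                    (trans (cong (X *_) (parallel (proj₁ (at Ca)) (proj₁ (at Cl)) Lx (collinear Cl) l))
                      (sym (ℤ.*-assoc X X (h l l)))))
                  (Spike.tip (spike l Cl))
                where
                X = ω (h a) x
                Y = ω (h l) x
            wide-goal : γ ≢ + 0 → Goal
            wide-goal γ≢0 =
              (λ k → + 1 * h a k + + 1 * h b k) , L-comb (+ 1) (+ 1) (proj₁ (at Ca)) (proj₁ (at Cb)) , negative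
              where
              γ≥1 : + 0 ≤ γ - + 1
              γ≥1 = ≢0⇒≥1 γ (first b Cb) γ≢0
              at-tip : ∀ x y W → + 0 ≤ - x - W - + 1 → + 0 ≤ W - y → + 0 ≤ - (+ 1 * x + + 1 * y) - + 1
              at-tip x y W hx hy = hx ⊕ hy by solve (x ∷ y ∷ W ∷ [])
              at-tip′ : ∀ x y W → + 0 ≤ W - x → + 0 ≤ - y - W - + 1 → + 0 ≤ - (+ 1 * x + + 1 * y) - + 1
              at-tip′ x y W hx hy = hx ⊕ hy by solve (x ∷ y ∷ W ∷ [])
              negative : ∀ l → C l → + 0 ≤ - (+ 1 * h a l + + 1 * h b l) - + 1
              negative l Cl =
                decide (a ≟ l) (λ a≡l → subst (λ l → + 0 ≤ - (+ 1 * h a l + + 1 * h b l) - + 1) a≡l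
                  (at-tip (h a a) (h b a) (W a) (Spike.tip (spike a Ca)) (bound Cb a Ca))) λ a≢l →
                decide (b ≟ l) (λ b≡l → subst (λ l → + 0 ≤ - (+ 1 * h a l + + 1 * h b l) - + 1) b≡l
                  (at-tip′ (h a b) (h b b) (W b) (bound Ca b Cb) (Spike.tip (spike b Cb)))) λ b≢l →
                sum-negative (W l) α β γ (h l l) (h a l) (h b l) (W≥0 l Cl) (last l Cl) (first l Cl) γ≥1
                  (split l) (Spike.tip (spike l Cl))
                  (Spike.elsewhere (spike a Ca) l Cl a≢l) (Spike.elsewhere (spike b Cb) l Cl b≢l)
                  (dominated (W a) α β γ (h l a) (h a a) (h b a) (W≥0 a Ca) (last l Cl) (first l Cl) (first b Cb)
                    (split a) (Spike.elsewhere (spike l Cl) a Ca (λ e → a≢l (sym e)))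
                    (Spike.tip (spike a Ca)) (bound Cb a Ca))
                  (dominated (W b) β α γ (h l b) (h b b) (h a b) (W≥0 b Cb) (first l Cl) (last l Cl) (first b Cb)
                    (trans (split b) (ℤ.+-comm (α * h a b) (β * h b b)))
                    (Spike.elsewhere (spike l Cl) b Cb (λ e → b≢l (sym e)))
                    (Spike.tip (spike b Cb)) (bound Ca b Cb))
                where
                α = ω (h l) (h b)
                β = ω (h a) (h l)
                split : ∀ k → γ * h l k ≡ α * h a k + β * h b k
                split = decompose (proj₁ (at Ca)) (proj₁ (at Cb)) (proj₁ (at Cl))

        ¬¬goal : ¬ ¬ Goal
        ¬¬goal ¬goal = decide (Fin.any? C?)
          (λ someC → ¬¬-choice (λ i h → C i → Spike i h)
            (λ i k → decide (C? i)
              (λ Ci → ¬¬spike ¬goal i Ci λ (h , sp) → k (h , λ _ → sp))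
              -- `W` is only a default value for indices outside `C`.
              (λ ¬Ci → k (W , λ Ci → ⊥-elim (¬Ci Ci))))
            λ (h , sp) → ¬goal (spikes⇒goal someC h sp))
          (λ noC → ¬goal (u , Lu , λ k Ck → ⊥-elim (noC (k , Ck))))

-- From monomial ideals to polygons

Σℤ-single : ∀ {m} (f : Fin m → ℤ) i → (∀ k → i ≢ k → f k ≡ + 0) → Σℤ f ≡ f i
Σℤ-single {ℕ.suc m} f zero h =
  trans (cong (λ a → f zero + a) (trans (Σℤ-cong (λ k → h (suc k) λ ())) (Σℤ-0 m))) (ℤ.+-identityʳ (f zero))
Σℤ-single {ℕ.suc m} f (suc i) h =
  trans (cong₂ _+_ (h zero λ ()) (Σℤ-single (λ k → f (suc k)) i λ k i≢k → h (suc k) λ { refl → i≢k refl }))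
    (ℤ.+-identityˡ (f (suc i)))

Σℤ-δ : ∀ {m} i (f : Fin m → ℤ) → Σℤ (λ k → + δ i k * f k) ≡ f i
Σℤ-δ i f = trans (Σℤ-single (λ k → + δ i k * f k) i (λ k i≢k → cong (λ d → + d * f k) (δ-other i≢k)))
  (trans (cong (λ d → + d * f i) (δ-self i)) (ℤ.*-identityˡ (f i)))

pos-Σ : ∀ {m} (f : Fin m → ℕ) → + Σℕ f ≡ Σℤ (λ j → + f j)
pos-Σ {ℕ.zero} f = refl
pos-Σ {ℕ.suc m} f = cong (λ a → + f zero + a) (pos-Σ (λ j → f (suc j)))

positive-term : ∀ {m} (f : Fin m → ℕ) → 0 ℕ.< Σℕ f → ∃ λ j → 0 ℕ.< f j
positive-term {ℕ.suc m} f h with f zero in eq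
... | ℕ.suc a = zero , subst (0 ℕ.<_) (sym eq) (s≤s z≤n)
... | ℕ.zero with positive-term (λ j → f (suc j)) h
...   | j , hj = suc j , hj

<⇒0≤ : ∀ {a} → 0 ℕ.< a → + 0 ≤ + a - + 1
<⇒0≤ (s≤s _) = +≤+ z≤n

nonzero-if : ∀ {n} (p : Vecℤ n) → ¬ (∀ k → p k ≡ + 0) → Nonzero p
nonzero-if p h = Fin.¬∀⟶∃¬ _ _ (λ k → p k ℤ.≟ + 0) h

module _ {d n : ℕ} (A : Mat d n) where

  InL-resp : ∀ {p q} → (∀ k → p k ≡ q k) → InL A p → InL A q
  InL-resp e Lp j = trans (Σℤ-cong (λ i → cong (A j i *_) (sym (e i)))) (Lp j)

  InL-comb : ∀ a b {p q} → InL A p → InL A q → InL A (λ k → a * p k + b * q k)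
  InL-comb a b {p} {q} Lp Lq j =
    trans (Σℤ-cong (λ i → distribute (A j i) a b (p i) (q i)))
    (trans (Σℤ-linear a b (λ i → A j i * p i) (λ i → A j i * q i))
    (trans (cong₂ (λ x y → a * x + b * y) (Lp j) (Lq j)) (collapse a b)))
    where
    distribute : ∀ m a b x y → m * (a * x + b * y) ≡ a * (m * x) + b * (m * y)
    distribute = solve-∀
    collapse : ∀ a b → a * + 0 + b * + 0 ≡ + 0
    collapse = solve-∀

  Pointed : (Fin n → Set) → Exp n → Set
  Pointed C w = ∀ {p q r} x y z → InBody p → InBody q → InBody r →
    + 0 ≤ x → + 0 ≤ y → + 0 ≤ z → + 0 ≤ x + y + z - + 1 →
    (∀ k → x * p k + y * q k + z * r k ≡ + 0) → ⊥
    where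
    InBody : Vecℤ n → Set
    InBody p = InL A p × Nonzero p × (∀ k → C k → + 0 ≤ + w k - p k)

  module _ (τ : Subset n) (w : Exp n) (colon : ∀ u → VL A (λ i → u i ℕ.+ w i) ⇔ InP τ u) where

    -- Outside τ the three vectors are bounded by w; inside τ the exponent u makes room for them.
    assoc⇒pointed : Pointed (_∉ τ) w
    assoc⇒pointed {p} {q} {r} (+ x) (+ y) (+ z) p∈ q∈ r∈ _ _ _ total e =
      -- `u` vanishes outside `τ`, so `x^u` is not in `P_τ`, although the relation makes `u + w` a
      -- non-vertex of its fiber.
      impossible (Equivalence.to (colon u) (v , (3 , point , weight , fiber , distinct , weight>0 , barycentre) , λ i → ℕ.≤-refl))
      where
      u : Exp n
      u k = decide (k ∈? τ) (λ _ → ∣ p k ∣ ℕ.+ ∣ q k ∣ ℕ.+ ∣ r k ∣) (λ _ → 0)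
      u-outside : ∀ k → k ∉ τ → u k ≡ 0
      u-outside k k∉τ with k ∈? τ
      ... | yes k∈τ = ⊥-elim (k∉τ k∈τ)
      ... | no _ = refl
      impossible : InP τ u → ⊥
      impossible (k , k∉τ , uk>0) = ℕ.<-irrefl (sym (u-outside k k∉τ)) uk>0
      v : Exp n
      v k = u k ℕ.+ w k
      vectors : Fin 3 → Vecℤ n
      vectors zero = p
      vectors (suc zero) = q
      vectors (suc (suc _)) = r
      vectors∈ : ∀ j → InL A (vectors j) × Nonzero (vectors j) × (∀ k → k ∉ τ → + 0 ≤ + w k - vectors j k)
      vectors∈ zero = p∈
      vectors∈ (suc zero) = q∈
      vectors∈ (suc (suc _)) = r∈
      weight : Fin 3 → ℕ
      weight zero = x
      weight (suc zero) = y
      weight (suc (suc _)) = z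
      a≤+∣a∣ : ∀ a → + 0 ≤ + ∣ a ∣ - a
      a≤+∣a∣ (+ a) = 0≤0 by sym (ℤ.+-inverseʳ (+ a))
      a≤+∣a∣ (-[1+ a ]) = +≤+ z≤n
      component : ∀ j k → + 0 ≤ + (∣ p k ∣ ℕ.+ ∣ q k ∣ ℕ.+ ∣ r k ∣) - vectors j k
      component zero k = a≤+∣a∣ (p k) ⊕ +≤+ {0} {∣ q k ∣} z≤n ⊕ +≤+ {0} {∣ r k ∣} z≤n
        by eq (p k) (+ ∣ p k ∣) (+ ∣ q k ∣) (+ ∣ r k ∣)
        where
        eq : ∀ p P Q R → P - p + Q + R ≡ P + Q + R - p
        eq = solve-∀
      component (suc zero) k = a≤+∣a∣ (q k) ⊕ +≤+ {0} {∣ p k ∣} z≤n ⊕ +≤+ {0} {∣ r k ∣} z≤n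
        by eq (q k) (+ ∣ p k ∣) (+ ∣ q k ∣) (+ ∣ r k ∣)
        where
        eq : ∀ q P Q R → Q - q + P + R ≡ P + Q + R - q
        eq = solve-∀
      component (suc (suc _)) k = a≤+∣a∣ (r k) ⊕ +≤+ {0} {∣ p k ∣} z≤n ⊕ +≤+ {0} {∣ q k ∣} z≤n
        by eq (r k) (+ ∣ p k ∣) (+ ∣ q k ∣) (+ ∣ r k ∣)
        where
        eq : ∀ r P Q R → R - r + P + Q ≡ P + Q + R - r
        eq = solve-∀
      room : ∀ j k → + 0 ≤ + v k - vectors j k
      room j k with k ∈? τ
      ... | yes _ = component j k ⊕ +≤+ {0} {w k} z≤n by eq (+ (∣ p k ∣ ℕ.+ ∣ q k ∣ ℕ.+ ∣ r k ∣)) (vectors j k) (+ w k)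
        where
        eq : ∀ u p w → u - p + w ≡ u + w - p
        eq = solve-∀
      ... | no k∉τ = proj₂ (proj₂ (vectors∈ j)) k k∉τ
      point : Fin 3 → Exp n
      point j k = ∣ + v k - vectors j k ∣
      +point : ∀ j k → + point j k ≡ + v k - vectors j k
      +point j k = ℤ.0≤i⇒+∣i∣≡i (room j k)
      back : ∀ v p → p ≡ v - (v - p)
      back = solve-∀
      shift : ∀ j k → vectors j k ≡ + v k - + point j k
      shift j k = trans (back (+ v k) (vectors j k)) (cong (λ a → + v k - a) (sym (+point j k)))
      fiber : ∀ j → InFiber A v (point j)
      fiber j = InL-resp (shift j) (proj₁ (vectors∈ j))
      distinct : ∀ j → ∃ λ k → point j k ≢ v k
      distinct j with proj₁ (proj₂ (vectors∈ j))
      ... | k , pk≢0 = k , λ eq → pk≢0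
        (trans (shift j k) (trans (cong (λ a → + v k - + a) eq) (ℤ.+-inverseʳ (+ v k))))
      weight>0 : 0 ℕ.< Σℕ weight
      weight>0 = ℕ.≤∧≢⇒< z≤n λ eq → ≥1⇒≢0 total (trans (regroup (+ x) (+ y) (+ z)) (cong +_ (sym eq)))
        where
        regroup : ∀ a b c → a + b + c ≡ a + (b + (c + + 0))
        regroup = solve-∀
      barycentre : ∀ k → Σℕ (λ j → weight j ℕ.* point j k) ≡ Σℕ weight ℕ.* v k
      barycentre k = ℤ.+-injective (trans (pos-Σ (λ j → weight j ℕ.* point j k))
        (trans (Σℤ-cong (λ j → trans (ℤ.pos-* (weight j) (point j k)) (cong (+ weight j *_) (+point j k))))
        (trans (expand (+ x) (+ y) (+ z) (+ v k) (p k) (q k) (r k))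
        (trans (cong (λ a → (+ x + (+ y + (+ z + + 0))) * + v k - a) (e k))
        (trans (ℤ.+-identityʳ _) (sym (ℤ.pos-* (Σℕ weight) (v k))))))))
        where
        expand : ∀ x y z v p q r → x * (v - p) + (y * (v - q) + (z * (v - r) + + 0)) ≡
          (x + (y + (z + + 0))) * v - (x * p + y * q + z * r)
        expand = solve-∀

    -- `x_l` is in `P_τ`, so some non-vertex `x^v` divides `x_l x^w`. Subtracting its fiber points
    -- from `v` moves the convex relation to the origin; the differences are at most `v`, since
    -- exponents are nonnegative.
    assoc⇒relation : ∀ l → l ∉ τ →
      Relation (λ p → InL A p × Nonzero p × (∀ k → k ∉ τ → + 0 ≤ + (δ l k ℕ.+ w k) - p k))
    assoc⇒relation l l∉τ with Equivalence.from (colon (δ l)) (l , l∉τ , subst (0 ℕ.<_) (sym (δ-self l)) (s≤s z≤n))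
    ... | v , (m , point , lam , fiber , distinct , lam>0 , barycentre) , v≤ = record
      { pt = λ j k → + v k - + point j k
      ; wt = λ j → + lam j
      ; wt≥0 = λ j → +≤+ z≤n
      ; heavy = heavy
      ; pt∈ = λ j → fiber j , nonzero j , λ k _ → bound j k
      ; balanced = balanced
      }
      where
      heavy : ∃ λ j → + 0 ≤ + lam j - + 1
      heavy with positive-term lam lam>0
      ... | j , h = j , <⇒0≤ h
      nonzero : ∀ j → Nonzero (λ k → + v k - + point j k)
      nonzero j with distinct j
      ... | k , ne = k , λ eq → ne (sym (ℤ.+-injective (ℤ.i-j≡0⇒i≡j (+ v k) (+ point j k) eq)))
      bound : ∀ j k → + 0 ≤ + (δ l k ℕ.+ w k) - (+ v k - + point j k)
      bound j k = ℤ.i≤j⇒0≤j-i (+≤+ (v≤ k)) ⊕ +≤+ {0} {point j k} z≤n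
        by eq (+ (δ l k ℕ.+ w k)) (+ v k) (+ point j k)
        where
        eq : ∀ a v p → a - v + p ≡ a - (v - p)
        eq = solve-∀
      balanced : ∀ k → Σℤ (λ j → + lam j * (+ v k - + point j k)) ≡ + 0
      balanced k =
        trans (Σℤ-cong (λ j → expand (+ lam j) (+ v k) (+ point j k)))
        (trans (Σℤ-linear (+ v k) (- + 1) (λ j → + lam j) (λ j → + lam j * + point j k))
        (trans (cong₂ (λ a b → + v k * a + (- + 1) * b) (sym (pos-Σ lam))
          (trans (Σℤ-cong (λ j → sym (ℤ.pos-* (lam j) (point j k))))
          (trans (sym (pos-Σ (λ j → lam j ℕ.* point j k)))
          (trans (cong +_ (barycentre k)) (ℤ.pos-* (Σℕ lam) (v k))))))
          (collapse (+ v k) (+ Σℕ lam))))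
        where
        expand : ∀ a v p → a * (v - p) ≡ v * a + (- + 1) * (a * p)
        expand = solve-∀
        collapse : ∀ v a → v * a + (- + 1) * (a * v) ≡ + 0
        collapse = solve-∀

  -- `LinDep` of three vectors with `Σℤ` unfolded, so that the rank hypothesis has this type by
  -- computation.
  DependentTriple : Vecℤ n → Vecℤ n → Vecℤ n → Set
  DependentTriple p q r = ∃ λ (c : Fin 3 → ℤ) → (∃ λ j → c j ≢ + 0) ×
    (∀ i → c zero * p i + (c (suc zero) * q i + (c (suc (suc zero)) * r i + + 0)) ≡ + 0)

  -- Kernels of rank two

  module RankTwoKernel
    {u v : Vecℤ n} (Lu : InL A u) (Lv : InL A v)
    (independent : ∀ a b → a ≢ + 0 ⊎ b ≢ + 0 → ¬ (∀ k → a * u k + b * v k ≡ + 0))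
    (dependent : ∀ p q r → InL A p → InL A q → InL A r → DependentTriple p q r) where

    u≢0 : Nonzero u
    u≢0 = nonzero-if u λ h → independent (+ 1) (+ 0) (inj₁ λ ()) λ k →
      cong (λ a → + 1 * a + + 0 * v k) (h k)

    -- If every minor through a nonzero `u s` vanished, `- v s` and `u s` would be coefficients of a
    -- dependency. The minor found fixes the coordinates of `ω`.
    nonzero-minor : ∃ λ s → ∃ λ t → u s * v t - u t * v s ≢ + 0
    nonzero-minor with u≢0
    ... | s , us≢0 = s , nonzero-if (λ t → u s * v t - u t * v s) λ h →
      independent (- v s) (u s) (inj₂ us≢0) λ k → trans (reorder (u s) (v s) (u k) (v k)) (h k)
      where
      reorder : ∀ a b x y → (- b) * x + a * y ≡ a * y - x * b
      reorder = solve-∀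

    module _ (s t : Fin n) where
      open Lattice (InL A) InL-resp InL-comb s t using (ω)

      -- The left side is the determinant of `p`, `q`, `r` in the columns `s`, `t`, `k`. Times any
      -- coefficient of a dependency, it is a cofactor combination of the dependency in these
      -- columns.
      cramer : ∀ {p q r} → InL A p → InL A q → InL A r → ∀ k → ω q r * p k + ω r p * q k + ω p q * r k ≡ + 0
      cramer {p} {q} {r} Lp Lq Lr k with dependent p q r Lp Lq Lr
      ... | c , (j , cj≢0) , e = *-cancel-≡0 cj≢0 (scaled j)
        where
        vanish : ∀ {a b c} x y z → a ≡ + 0 → b ≡ + 0 → c ≡ + 0 → a * x + b * y + c * z ≡ + 0
        vanish x y z refl refl refl = refl
        scaled : ∀ j → c j * (ω q r * p k + ω r p * q k + ω p q * r k) ≡ + 0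
        scaled zero = trans
          (eq (c zero) (c (suc zero)) (c (suc (suc zero))) (p s) (p t) (p k) (q s) (q t) (q k) (r s) (r t) (r k))
          (vanish _ _ _ (e s) (e t) (e k))
          where
          eq : ∀ c₁ c₂ c₃ p₁ p₂ p₃ q₁ q₂ q₃ r₁ r₂ r₃ →
            c₁ * ((q₁ * r₂ - q₂ * r₁) * p₃ + (r₁ * p₂ - r₂ * p₁) * q₃ + (p₁ * q₂ - p₂ * q₁) * r₃) ≡
            (c₁ * p₁ + (c₂ * q₁ + (c₃ * r₁ + + 0))) * (q₂ * r₃ - q₃ * r₂) +
            (c₁ * p₂ + (c₂ * q₂ + (c₃ * r₂ + + 0))) * (q₃ * r₁ - q₁ * r₃) +
            (c₁ * p₃ + (c₂ * q₃ + (c₃ * r₃ + + 0))) * (q₁ * r₂ - q₂ * r₁)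
          eq = solve-∀
        scaled (suc zero) = trans
          (eq (c zero) (c (suc zero)) (c (suc (suc zero))) (p s) (p t) (p k) (q s) (q t) (q k) (r s) (r t) (r k))
          (vanish _ _ _ (e s) (e t) (e k))
          where
          eq : ∀ c₁ c₂ c₃ p₁ p₂ p₃ q₁ q₂ q₃ r₁ r₂ r₃ →
            c₂ * ((q₁ * r₂ - q₂ * r₁) * p₃ + (r₁ * p₂ - r₂ * p₁) * q₃ + (p₁ * q₂ - p₂ * q₁) * r₃) ≡
            (c₁ * p₁ + (c₂ * q₁ + (c₃ * r₁ + + 0))) * (r₂ * p₃ - r₃ * p₂) +
            (c₁ * p₂ + (c₂ * q₂ + (c₃ * r₂ + + 0))) * (r₃ * p₁ - r₁ * p₃) +
            (c₁ * p₃ + (c₂ * q₃ + (c₃ * r₃ + + 0))) * (r₁ * p₂ - r₂ * p₁)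
          eq = solve-∀
        scaled (suc (suc zero)) = trans
          (eq (c zero) (c (suc zero)) (c (suc (suc zero))) (p s) (p t) (p k) (q s) (q t) (q k) (r s) (r t) (r k))
          (vanish _ _ _ (e s) (e t) (e k))
          where
          eq : ∀ c₁ c₂ c₃ p₁ p₂ p₃ q₁ q₂ q₃ r₁ r₂ r₃ →
            c₃ * ((q₁ * r₂ - q₂ * r₁) * p₃ + (r₁ * p₂ - r₂ * p₁) * q₃ + (p₁ * q₂ - p₂ * q₁) * r₃) ≡
            (c₁ * p₁ + (c₂ * q₁ + (c₃ * r₁ + + 0))) * (p₂ * q₃ - p₃ * q₂) +
            (c₁ * p₂ + (c₂ * q₂ + (c₃ * r₂ + + 0))) * (p₃ * q₁ - p₁ * q₃) +
            (c₁ * p₃ + (c₂ * q₃ + (c₃ * r₃ + + 0))) * (p₁ * q₂ - p₂ * q₁)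
          eq = solve-∀

    assoc⇒¬¬negative : ∀ τ → IsAssoc (VL A) τ → ¬ ¬ ∃ λ g → InL A g × (∀ k → k ∉ τ → + 0 ≤ - g k - + 1)
    assoc⇒¬¬negative τ (w , colon) = from-minor nonzero-minor
      where
      from-minor : (∃ λ s → ∃ λ t → u s * v t - u t * v s ≢ + 0) →
        ¬ ¬ ∃ λ g → InL A g × (∀ k → k ∉ τ → + 0 ≤ - g k - + 1)
      from-minor (s , t , minor≢0) =
        Lattice.RankTwoLattice.Polygon.¬¬goal (InL A) InL-resp InL-comb s t
          (cramer s t) Lu Lv minor≢0 (λ k → ¬? (k ∈? τ)) w (assoc⇒pointed τ w colon) (assoc⇒relation τ w colon)

    module _ (positiveFree : PositiveFree A) where

      ¬assoc-∅ : ¬ IsAssoc (VL A) ∅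
      ¬assoc-∅ assoc = assoc⇒¬¬negative ∅ assoc λ (g , Lg , negative) →
        ≥1⇒≢0 (negative (proj₁ u≢0) ∉⊥) (positiveFree (λ k → - g k)
          (InL-resp (λ k → eq (g k)) (InL-comb (- + 1) (+ 0) Lg Lg))
          (λ k → ≥1⇒≥0 (- g k) (negative k ∉⊥)) (proj₁ u≢0))
        where
        eq : ∀ a → (- + 1) * a + + 0 * a ≡ - a
        eq = solve-∀

    -- `p` and `- p` both obey every constraint outside `σ`, so a nonzero `p` would make the origin
    -- a midpoint.
    vanishing⇒zero : ∀ σ w → (∀ u → VL A (λ i → u i ℕ.+ w i) ⇔ InP σ u) →
      ∀ {p} → InL A p → (∀ k → k ∉ σ → p k ≡ + 0) → ∀ k → p k ≡ + 0
    vanishing⇒zero σ w colon {p} Lp h k = decide (p k ℤ.≟ + 0) id λ pk≢0 →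
      ⊥-elim (assoc⇒pointed σ w colon {p} {λ k → - p k} {p} (+ 1) (+ 1) (+ 0)
        (Lp , (k , pk≢0) , λ j j∉σ → +≤+ z≤n by cong (λ a → + w j - a) (sym (h j j∉σ)))
        (InL-resp (λ k → eq (p k)) (InL-comb (- + 1) (+ 0) Lp Lp) ,
          (k , λ e → pk≢0 (trans (sym (ℤ.neg-involutive (p k))) (cong -_ e))) ,
          λ j j∉σ → +≤+ z≤n by cong (λ a → + w j - - a) (sym (h j j∉σ)))
        (Lp , (k , pk≢0) , λ j j∉σ → +≤+ z≤n by cong (λ a → + w j - a) (sym (h j j∉σ)))
        0≤1 0≤1 0≤0 0≤1 (λ k → collapse (p k)))
      where
      eq : ∀ a → (- + 1) * a + + 0 * a ≡ - a
      eq = solve-∀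
      collapse : ∀ p → + 1 * p + + 1 * - p + + 0 * p ≡ + 0
      collapse = solve-∀

    -- By `vanishing⇒zero` the lattice injects into the coordinates outside `σ`; a single such
    -- coordinate `i` is defeated by `v i * u - u i * v`, which vanishes there.
    assoc⇒two-outside : ∀ σ → IsAssoc (VL A) σ → ∃ λ i → ∃ λ j → i ∉ σ × j ∉ σ × i ≢ j
    assoc⇒two-outside σ (w , colon) =
      decide (Fin.any? λ i → Fin.any? λ j → ¬? (i ∈? σ) ×-dec (¬? (j ∈? σ) ×-dec ¬? (i ≟ j))) id λ none →
      decide (Fin.any? λ i → ¬? (i ∈? σ))
        (λ (i , i∉σ) → ⊥-elim (single i (λ k k∉σ → decide (i ≟ k) id
          (λ i≢k → ⊥-elim (none (i , k , i∉σ , k∉σ , i≢k))))))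
        (λ empty → ⊥-elim (proj₂ u≢0 (vanishing⇒zero σ w colon Lu
          (λ k k∉σ → ⊥-elim (empty (k , k∉σ))) (proj₁ u≢0))))
      where
      swap : ∀ a b → b * a + (- a) * b ≡ + 0
      swap = solve-∀
      single : ∀ i → (∀ k → k ∉ σ → i ≡ k) → ⊥
      single i only = decide (u i ℤ.≟ + 0)
        (λ ui≡0 → proj₂ u≢0 (vanishing⇒zero σ w colon Lu
          (λ k k∉σ → subst (λ k → u k ≡ + 0) (only k k∉σ) ui≡0) (proj₁ u≢0)))
        (λ ui≢0 → independent (v i) (- u i)
          (inj₂ λ e → ui≢0 (trans (sym (ℤ.neg-involutive (u i))) (cong -_ e)))
          (vanishing⇒zero σ w colon (InL-comb (v i) (- u i) Lu Lv)
            λ k k∉σ → subst (λ k → v i * u k + (- u i) * v k ≡ + 0) (only k k∉σ) (swap (u i) (v i))))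

    -- Faces of the cone

    module _ (τ : Subset n) (face : IsFace A τ) where
      private
        c = proj₁ face
        Y : Fin n → ℤ
        Y i = Σℤ (λ j → c j * A j i)
        Y≥0 : ∀ i → + 0 ≤ Y i
        Y≥0 = proj₁ (proj₂ face)
        on-face : ∀ x → InCone A τ x ⇔ (InCone A full x × Σℤ (λ j → c j * x j) ≡ + 0)
        on-face = proj₂ (proj₂ face)

      column∈cone : ∀ σ i → i ∈ σ → InCone A σ (λ j → A j i)
      column∈cone σ i i∈σ = 1 , δ i , s≤s z≤n , (λ k k∉σ → δ-other {i = i} {k} λ { refl → k∉σ i∈σ }) ,
        λ j → trans (ℤ.*-identityˡ (A j i)) (sym (Σℤ-δ i (A j)))

      Y-on-τ : ∀ i → i ∈ τ → Y i ≡ + 0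
      Y-on-τ i i∈τ = proj₂ (Equivalence.to (on-face (λ j → A j i)) (column∈cone τ i i∈τ))

      orthogonal : ∀ g → InL A g → Σℤ (λ i → (- g i) * Y i) ≡ + 0
      orthogonal g Lg =
        trans (Σℤ-cong (λ i → trans (sym (Σℤ-scale (- g i) (λ j → c j * A j i)))
          (Σℤ-cong (λ j → reorder (g i) (c j) (A j i)))))
        (trans (Σℤ-swap (λ i j → (- c j) * (A j i * g i)))
        (trans (Σℤ-cong (λ j → trans (Σℤ-scale (- c j) (λ i → A j i * g i))
                                (trans (cong ((- c j) *_) (Lg j)) (ℤ.*-zeroʳ (- c j)))))
          (Σℤ-0 d)))
        where
        reorder : ∀ g c a → (- g) * (c * a) ≡ (- c) * (a * g)
        reorder = solve-∀

      -- Σ g_i (c · a_i) = 0 has terms of one sign, so c · a_i = 0 and the face is the whole cone.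
      columns∈cone-τ : ∀ g → InL A g → (∀ k → k ∉ τ → + 0 ≤ - g k - + 1) → ∀ i → i ∉ τ → InCone A τ (λ j → A j i)
      columns∈cone-τ g Lg negative i i∉τ =
        Equivalence.from (on-face (λ j → A j i)) (column∈cone full i ∈⊤ , Y≡0)
        where
        terms≥0 : ∀ k → + 0 ≤ (- g k) * Y k
        terms≥0 k = decide (k ∈? τ)
          (λ k∈τ → 0≤0 by sym (trans (cong ((- g k) *_) (Y-on-τ k k∈τ)) (ℤ.*-zeroʳ (- g k))))
          (λ k∉τ → ≥1⇒≥0 (- g k) (negative k k∉τ) ⊗ Y≥0 k)
        Y≡0 : Y i ≡ + 0
        Y≡0 = *-cancel-≡0 { - g i} (≥1⇒≢0 (negative i i∉τ))
          (zero-terms (λ k → (- g k) * Y k) terms≥0 (orthogonal g Lg) i)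

    -- The cone identity puts `m e_i - lam` in the kernel; as `lam` is supported on `τ`, outside `τ`
    -- only the entry `m` at `i` remains.
    relation-vector : ∀ τ i → i ∉ τ → InCone A τ (λ j → A j i) →
      ∃ λ g → InL A g × g i ≢ + 0 × (∀ k → k ∉ τ → i ≢ k → g k ≡ + 0)
    relation-vector τ i i∉τ (m , lam , m>0 , support , e) =
      g , Lg , (λ gi≡0 → ℕ.<-irrefl (sym (ℤ.+-injective (trans (sym gi) gi≡0))) m>0) ,
      λ k k∉τ i≢k → trans (cong₂ (λ a b → + m * + a - + b) (δ-other i≢k) (support k k∉τ))
                          (trans (ℤ.+-identityʳ (+ m * + 0)) (ℤ.*-zeroʳ (+ m)))
      where
      g : Vecℤ n
      g k = + m * + δ i k - + lam k
      gi : g i ≡ + m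
      gi = trans (cong₂ (λ a b → + m * + a - + b) (δ-self i) (support i i∉τ))
                 (trans (ℤ.+-identityʳ (+ m * + 1)) (ℤ.*-identityʳ (+ m)))
      expand : ∀ a m d l → a * (m * d - l) ≡ m * (d * a) + (- + 1) * (l * a)
      expand = solve-∀
      collapse : ∀ a → a + (- + 1) * a ≡ + 0
      collapse = solve-∀
      Lg : InL A g
      Lg j = trans (Σℤ-cong (λ k → expand (A j k) (+ m) (+ δ i k) (+ lam k)))
        (trans (Σℤ-linear (+ m) (- + 1) (λ k → + δ i k * A j k) (λ k → + lam k * A j k))
        (trans (cong₂ (λ a b → + m * a + (- + 1) * b) (Σℤ-δ i (A j)) (sym (e j)))
          (collapse (+ m * A j i))))

    -- In the coordinates `i`, `j`, `k` the vectors form a diagonal matrix with nonzero diagonal, so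
    -- every coefficient of a dependency is zero.
    ¬three-relation-vectors : ∀ {i j k} {f g h : Vecℤ n} → InL A f → InL A g → InL A h →
      f i ≢ + 0 → g i ≡ + 0 → h i ≡ + 0 → f j ≡ + 0 → g j ≢ + 0 → h j ≡ + 0 →
      f k ≡ + 0 → g k ≡ + 0 → h k ≢ + 0 → ⊥
    ¬three-relation-vectors {i} {j} {k} {f} {g} {h} Lf Lg Lh fi gi hi fj gj hj fk gk hk
      with dependent f g h Lf Lg Lh
    ... | c , (l , cl≢0) , e = cl≢0 (coefficient l)
      where
      first : ∀ a b c x → a * x + (b * + 0 + (c * + 0 + + 0)) ≡ x * a
      first = solve-∀
      second : ∀ a b c x → a * + 0 + (b * x + (c * + 0 + + 0)) ≡ x * b
      second = solve-∀
      third : ∀ a b c x → a * + 0 + (b * + 0 + (c * x + + 0)) ≡ x * c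
      third = solve-∀
      c₀ = c zero
      c₁ = c (suc zero)
      c₂ = c (suc (suc zero))
      coefficient : ∀ l → c l ≡ + 0
      coefficient zero = *-cancel-≡0 fi (trans (sym (trans
        (cong₂ (λ y z → c₀ * f i + (c₁ * y + (c₂ * z + + 0))) gi hi) (first c₀ c₁ c₂ (f i)))) (e i))
      coefficient (suc zero) = *-cancel-≡0 gj (trans (sym (trans
        (cong₂ (λ x z → c₀ * x + (c₁ * g j + (c₂ * z + + 0))) fj hj) (second c₀ c₁ c₂ (g j)))) (e j))
      coefficient (suc (suc zero)) = *-cancel-≡0 hk (trans (sym (trans
        (cong₂ (λ x y → c₀ * x + (c₁ * y + (c₂ * h k + + 0))) fk gk) (third c₀ c₁ c₂ (h k)))) (e k))

    embedded⇒¬face : ∀ τ → IsEmbedded (VL A) τ → ¬ IsFace A τ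
    embedded⇒¬face τ (assocτ , σ , assocσ , τ⊆σ , i , i∈σ , i∉τ) face =
      assoc⇒¬¬negative τ assocτ λ (g , Lg , negative) →
        contradict (λ k k∉τ → relation-vector τ k k∉τ (columns∈cone-τ τ face g Lg negative k k∉τ))
          (assoc⇒two-outside σ assocσ)
      where
      contradict : (∀ k → k ∉ τ → ∃ λ g → InL A g × g k ≢ + 0 × (∀ l → l ∉ τ → k ≢ l → g l ≡ + 0)) →
        (∃ λ j → ∃ λ k → j ∉ σ × k ∉ σ × j ≢ k) → ⊥
      contradict vector (j , k , j∉σ , k∉σ , j≢k)
        with vector i i∉τ | vector j (λ j∈τ → j∉σ (τ⊆σ j∈τ)) | vector k (λ k∈τ → k∉σ (τ⊆σ k∈τ))
      ... | f , Lf , fi , f0 | g , Lg , gj , g0 | h , Lh , hk , h0 =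
        ¬three-relation-vectors Lf Lg Lh
          fi (g0 i i∉τ (λ j≡i → i≢j (sym j≡i))) (h0 i i∉τ (λ k≡i → i≢k (sym k≡i)))
          (f0 j j∉τ i≢j) gj (h0 j j∉τ (λ k≡j → j≢k (sym k≡j)))
          (f0 k k∉τ i≢k) (g0 k k∉τ j≢k) hk
        where
        j∉τ : j ∉ τ
        j∉τ j∈τ = j∉σ (τ⊆σ j∈τ)
        k∉τ : k ∉ τ
        k∉τ k∈τ = k∉σ (τ⊆σ k∈τ)
        i≢j : i ≢ j
        i≢j refl = j∉σ i∈σ
        i≢k : i ≢ k
        i≢k refl = k∉σ i∈σ

theorem3p11 : ∀ {d n : ℕ} (A : Mat d n) → RankTwo A → PositiveFree A →
    ((τ : Subset n) → IsEmbedded (VL A) τ → ¬ IsFace A τ)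
    × ¬ IsAssoc (VL A) ∅
theorem3p11 A ((u , v , Lu , Lv , uv-independent) , dependent) positiveFree =
  embedded⇒¬face , ¬assoc-∅ positiveFree
  where
  independent : ∀ a b → a ≢ + 0 ⊎ b ≢ + 0 → ¬ (∀ k → a * u k + b * v k ≡ + 0)
  independent a b nz e = uv-independent (c , nonzero nz , λ k →
    trans (cong (λ x → a * u k + x) (ℤ.+-identityʳ (b * v k))) (e k))
    where
    c : Fin 2 → ℤ
    c zero = a
    c (suc _) = b
    nonzero : a ≢ + 0 ⊎ b ≢ + 0 → ∃ λ j → c j ≢ + 0
    nonzero (inj₁ a≢0) = zero , a≢0
    nonzero (inj₂ b≢0) = suc zero , b≢0
  open RankTwoKernel A Lu Lv independent dependent
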